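{- Let $k \ge 1$ and $h \ge 2$ be positive integers and let $G = (U,V,E)$ be a bipartite graph. Suppose that for all $S \subseteq U$, $$|\Gamma(S)| \ge \left(h-1+\frac{1}{\lceil k/h \rceil}\right)|S|.$$ Then $G$ has an $(h,hk)$-matching.
   Context: All graphs are finite and simple. $G=(U,V,E)$ denotes a bipartite graph with left vertex class $U$, right vertex class $V$ and edge set $E$. For a set $S$ of vertices, $\Gamma(S)$ denotes the set of vertices adjacent to at least one vertex of $S$. For positive integers $t \ge s$, an $(s,t)$-matching in $G=(U,V,E)$ is a subset $F \subseteq E$ such that, in the graph $H=(U,V,F)$, each connected component is a tree with at most $t$ edges, and every $u \in U$ has degree $d_H(u)=s$. -}

module Defs where

open import Data.Bool.Base using (if_then_else_)
open import Data.Fin.Base using (Fin)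
open import Data.Fin.Properties using (any?)
open import Data.Fin.Subset using (Subset; _∈_; _⊆_; _∩_; ⊥; ∣_∣)
open import Data.Fin.Subset.Properties using (_∈?_)
open import Data.Integer.Base using (+_)
open import Data.List.Base using (List; []; _∷_; _++_; length)
open import Data.List.Relation.Unary.Linked using (Linked)
open import Data.List.Relation.Unary.Unique.Propositional using (Unique)
open import Data.Nat.Base using (ℕ; suc; pred; _+_; _≤_; NonZero; NonTrivial; nonTrivial⇒nonZero; >-nonZero; s≤s)
open import Data.Nat.DivMod using (_/_; m≥n⇒m/n>0)
open import Data.Nat.Properties using (m≤n+m)
open import Data.Product.Base using (∃-syntax; _×_; _,_)
open import Data.Rational.Base as ℚ using (ℚ; 1ℚ)
open import Data.Sum.Base using (_⊎_; inj₁; inj₂)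
open import Data.Vec.Base using (tabulate; sum)
open import Function.Bundles using (_⇔_)
open import Level using (0ℓ)
open import Relation.Binary.Construct.Closure.ReflexiveTransitive using (Star)
open import Relation.Binary.Core using (Rel)
open import Relation.Binary.PropositionalEquality.Core using (_≡_)
open import Relation.Nullary.Decidable.Core using (does; _×-dec_)
open import Relation.Nullary.Negation.Core using (¬_)

-- A bipartite graph with classes U = Fin m and V = Fin n, or equally an edge
-- set F ⊆ U × V: each u : U is sent to its set of neighbours.
BipartiteGraph : ℕ → ℕ → Set
BipartiteGraph m n = Fin m → Subset n

_⊆ᴱ_ : ∀ {m n} → BipartiteGraph m n → BipartiteGraph m n → Set
F ⊆ᴱ E = ∀ u → F u ⊆ E u

size : ∀ {m n} → BipartiteGraph m n → ℕ
size F = sum (tabulate (λ u → ∣ F u ∣))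

deg : ∀ {m n} → BipartiteGraph m n → Fin m → ℕ
deg F u = ∣ F u ∣

Γ : ∀ {m n} → BipartiteGraph m n → Subset m → Subset n
Γ E S = tabulate (λ v → does (any? (λ u → (u ∈? S) ×-dec (v ∈? E u))))

Vertex : ℕ → ℕ → Set
Vertex m n = Fin m ⊎ Fin n

data Adj {m n} (F : BipartiteGraph m n) : Rel (Vertex m n) 0ℓ where
  uv : ∀ {u v} → v ∈ F u → Adj F (inj₁ u) (inj₂ v)
  vu : ∀ {u v} → v ∈ F u → Adj F (inj₂ v) (inj₁ u)

Reachable : ∀ {m n} → BipartiteGraph m n → Rel (Vertex m n) 0ℓ
Reachable F = Star (Adj F)

VertexSet : ℕ → ℕ → Set
VertexSet m n = Subset m × Subset n

_∈ⱽ_ : ∀ {m n} → Vertex m n → VertexSet m n → Set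
inj₁ u ∈ⱽ (A , B) = u ∈ A
inj₂ v ∈ⱽ (A , B) = v ∈ B

-- The edges of the subgraph induced on a vertex set.
_[_] : ∀ {m n} → BipartiteGraph m n → VertexSet m n → BipartiteGraph m n
(F [ A , B ]) u = if does (u ∈? A) then F u ∩ B else ⊥

-- A component is the set of all vertices reachable from some vertex x.  The
-- graph is finite, so reachability is decidable and every x does lie in such a C.
IsComponent : ∀ {m n} → BipartiteGraph m n → VertexSet m n → Set
IsComponent F C = ∃[ x ] (∀ y → (y ∈ⱽ C) ⇔ Reachable F x y)

-- x ∷ xs lists the vertices of a cycle in order, without repeating x at the end.
IsCycle : ∀ {m n} → BipartiteGraph m n → Vertex m n → List (Vertex m n) → Set
IsCycle F x xs = 2 ≤ length xs × Unique (x ∷ xs) × Linked (Adj F) (x ∷ xs ++ x ∷ [])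

Acyclic : ∀ {m n} → BipartiteGraph m n → Set
Acyclic F = ∀ x xs → ¬ IsCycle F x xs

-- The graph with vertex set C and edge set F [ C ] is a tree.
record IsTreeOn {m n} (F : BipartiteGraph m n) (C : VertexSet m n) : Set where
  field
    nonempty  : ∃[ x ] (x ∈ⱽ C)
    connected : ∀ {x y} → x ∈ⱽ C → y ∈ⱽ C → Reachable (F [ C ]) x y
    acyclic   : Acyclic (F [ C ])

record IsMatching {m n} (s t : ℕ) (E F : BipartiteGraph m n) : Set where
  field
    subgraph       : F ⊆ᴱ E
    component-tree : ∀ C → IsComponent F C → IsTreeOn F C
    component-size : ∀ C → IsComponent F C → size (F [ C ]) ≤ t
    degree         : ∀ u → deg F u ≡ s

-- With ℕ's truncating division, ⌈ k / h ⌉ is ⌊ (k + (h - 1)) / h ⌋.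
⌈_/_⌉ : (k h : ℕ) .{{_ : NonZero h}} → ℕ
⌈ k / h ⌉ = (k + pred h) / h

⌈/⌉-nonZero : ∀ k h .{{_ : NonZero k}} .{{_ : NonZero h}} → NonZero ⌈ k / h ⌉
⌈/⌉-nonZero (suc k) (suc h) = >-nonZero (m≥n⇒m/n>0 (s≤s (m≤n+m h k)))

fromℕ : ℕ → ℚ
fromℕ a = + a ℚ./ 1

-- h - 1 + 1/⌈k/h⌉
expansion : (k h : ℕ) .{{_ : NonZero k}} .{{_ : NonTrivial h}} → ℚ
expansion k h = fromℕ h ℚ.- 1ℚ ℚ.+ (+ 1 ℚ./ ⌈ k / h ⌉)
  where instance
    h≢0 : NonZero h
    h≢0 = nonTrivial⇒nonZero h
    ⌈k/h⌉≢0 : NonZero ⌈ k / h ⌉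
    ⌈k/h⌉≢0 = ⌈/⌉-nonZero k h

{-# OPTIONS --safe #-}
-- Put q = ⌈k/h⌉.  By Hall's theorem every u ∈ U can send d = q (h - 1) + 1 units
-- along its edges so that each v ∈ V receives at most q.  Among all such integral
-- flows f one maximising ∑ f² has a forest as support, since otherwise shifting a
-- unit around a cycle one way or the other would increase ∑ f².  Root the trees of
-- this forest.  Each u has at least h neighbours in it, hence at least h - 1
-- children.  If u has h children let it keep just h of them, otherwise let it keep
-- its h - 1 children and its parent.  In a component of the result with a left and
-- b right vertices only the root may fail to have a parent, so b ≤ (h - 1) a + 1,
-- and only the root may have lost flow, keeping at least h units.  Comparing the
-- flow, d (a - 1) + h ≤ q b (or d a ≤ q b), which gives a ≤ (q - 1) h + 1 ≤ k.
module Submission where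

open import Data.Bool.Base using (if_then_else_)
open import Data.Fin.Base using (Fin; zero; suc)
open import Data.Fin.Properties using (_≟_; any?)
open import Data.Fin.Subset using (Subset; ∣_∣; _∈_; _∉_; _⊆_; _∪_; _-_; ∁; ⁅_⁆; ⊤; ⊥; inside; outside)
open import Data.Fin.Subset.Properties
open import Data.Integer.Base as ℤ using ()
import Data.Integer.Properties as ℤ
import Data.Integer.Tactic.RingSolver as ℤ
open import Data.List.Base using (List; []; _∷_; _++_)
open import Data.List.Relation.Unary.All as All using (All; []; _∷_)
import Data.List.Relation.Unary.All.Properties as All
open import Data.List.Relation.Unary.AllPairs using ([]; _∷_)
open import Data.List.Relation.Unary.Any using (Any; here; there)
open import Data.List.Relation.Unary.Linked as Linked using (Linked; [-]; _∷_)
open import Data.List.Relation.Unary.Unique.Propositional using (Unique)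
open import Data.Nat.Base hiding (_/_)
open import Data.Nat.DivMod using (m/n*n≤m)
open import Data.Nat.Properties hiding (_≟_)
open import Data.Nat.Tactic.RingSolver using (solve-∀)
open import Data.Product.Base using (∃-syntax; Σ-syntax; _×_; _,_; proj₁; proj₂)
open import Data.Rational.Base as ℚ using (1ℚ; toℚᵘ)
import Data.Rational.Properties as ℚ
open import Data.Rational.Unnormalised.Base as ℚᵘ using (mkℚᵘ; *≤*; _≃_)
import Data.Rational.Unnormalised.Properties as ℚᵘ
open import Data.Sum.Base using (_⊎_; inj₁; inj₂)
open import Data.Sum.Properties using (≡-dec)
open import Data.Vec.Base as Vec using (tabulate; []; _∷_)
open import Data.Vec.Properties using (lookup∘tabulate; lookup⇒[]=; []=⇒lookup)
open import Function.Base using (_∘_)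
open import Function.Bundles using (Equivalence)
open import Relation.Binary.Construct.Closure.ReflexiveTransitive using (Star; ε; _◅_; _◅◅_; reverse)
open import Relation.Binary.Definitions using (DecidableEquality; tri<; tri≈; tri>)
open import Relation.Binary.PropositionalEquality hiding ([_])
open import Relation.Nullary using (Dec; yes; no; does; ¬_; ¬?; contradiction; _×-dec_; _⊎-dec_)
open import Relation.Nullary.Decidable using (dec-true; dec-false; decidable-stable; map′)
open import Relation.Unary using (Decidable)
open import Defs

open import Algebra.Properties.Semiring.Sum +-*-semiring
  using (sum; sum-syntax; sum-cong-≗; ∑-distrib-+; ∑-comm; *-distribˡ-sum; *-distribʳ-sum)

private variable
  m n : ℕ
  P Q : Set

-- Finite sums

∑-mono : {f g : Fin n → ℕ} → (∀ i → f i ≤ g i) → sum f ≤ sum g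
∑-mono {zero}  f≤g = z≤n
∑-mono {suc n} f≤g = +-mono-≤ (f≤g zero) (∑-mono (f≤g ∘ suc))

∑-mono-< : {f g : Fin n → ℕ} → (∀ i → f i ≤ g i) → ∀ i → f i < g i → sum f < sum g
∑-mono-< f≤g zero    fi<gi = +-mono-<-≤ fi<gi (∑-mono (f≤g ∘ suc))
∑-mono-< f≤g (suc i) fi<gi = +-mono-≤-< (f≤g zero) (∑-mono-< (f≤g ∘ suc) i fi<gi)

≤∑ : (f : Fin n → ℕ) → ∀ i → f i ≤ sum f
≤∑ f zero    = m≤m+n _ _
≤∑ f (suc i) = ≤-trans (≤∑ (f ∘ suc) i) (m≤n+m _ _)

𝟙 : Dec P → ℕ
𝟙 P? = if does P? then 1 else 0

𝟙-yes : (P? : Dec P) → P → 𝟙 P? ≡ 1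
𝟙-yes P? p rewrite dec-true P? p = refl

𝟙-no : (P? : Dec P) → ¬ P → 𝟙 P? ≡ 0
𝟙-no P? ¬p rewrite dec-false P? ¬p = refl

𝟙-mono : (P? : Dec P) (Q? : Dec Q) → (P → Q) → 𝟙 P? ≤ 𝟙 Q?
𝟙-mono (no _)  _       _   = z≤n
𝟙-mono (yes _) (yes _) _   = ≤-refl
𝟙-mono (yes p) (no ¬q) P→Q = contradiction (P→Q p) ¬q

𝟙*-≤ : (P? : Dec P) {a b : ℕ} → (P → a ≤ b) → 𝟙 P? * a ≤ b
𝟙*-≤ (yes p) {a} a≤b = ≤-trans (≤-reflexive (*-identityˡ a)) (a≤b p)
𝟙*-≤ (no _)      a≤b = z≤n

∑0 : ∀ n → ∑[ j < n ] 0 ≡ 0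
∑0 zero    = refl
∑0 (suc n) = ∑0 n

𝟙*-mono : (P? : Dec P) {a b : ℕ} → (P → a ≤ b) → 𝟙 P? * a ≤ 𝟙 P? * b
𝟙*-mono (yes p) a≤b = +-monoˡ-≤ 0 (a≤b p)
𝟙*-mono (no _)  a≤b = z≤n

∑𝟙≟ : (i : Fin n) → ∑[ j < n ] 𝟙 (j ≟ i) ≡ 1
∑𝟙≟ {suc n} zero    = cong suc (∑0 n)
∑𝟙≟ {suc n} (suc i) = ∑𝟙≟ i

∣p∣≡∑ : (p : Subset n) → ∣ p ∣ ≡ ∑[ i < n ] 𝟙 (i ∈? p)
∣p∣≡∑ []            = refl
∣p∣≡∑ (inside  ∷ p) = cong suc (∣p∣≡∑ p)
∣p∣≡∑ (outside ∷ p) = ∣p∣≡∑ p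

module _ {P : Fin n → Set} (P? : Decidable P) where

  ⟪_⟫ : Subset n
  ⟪_⟫ = tabulate (does ∘ P?)

  ∈⟪⟫⁺ : ∀ {i} → P i → i ∈ ⟪_⟫
  ∈⟪⟫⁺ {i} p = lookup⇒[]= i _ (trans (lookup∘tabulate _ i) (dec-true (P? i) p))

  ∈⟪⟫⁻ : ∀ {i} → i ∈ ⟪_⟫ → P i
  ∈⟪⟫⁻ {i} i∈ with P? i | trans (sym (lookup∘tabulate (does ∘ P?) i)) ([]=⇒lookup i∈)
  ... | yes p | _ = p

∣∁[p∪⁅x⁆]∣<∣∁p∣ : (p : Subset n) {x : Fin n} → x ∉ p → ∣ ∁ (p ∪ ⁅ x ⁆) ∣ < ∣ ∁ p ∣
∣∁[p∪⁅x⁆]∣<∣∁p∣ p {x} x∉p = p⊂q⇒∣p∣<∣q∣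
  (p⊆q⇒∁p⊇∁q (p⊆p∪q ⁅ x ⁆) , x , x∉p⇒x∈∁p x∉p , x∈p⇒x∉∁p (q⊆p∪q p ⁅ x ⁆ (x∈⁅x⁆ x)))

-- Matrices

Matrix : ℕ → ℕ → Set
Matrix m n = Fin m → Fin n → ℕ

row : Matrix m n → Fin m → ℕ
row {n = n} f u = ∑[ v < n ] f u v

col : Matrix m n → Fin n → ℕ
col {m = m} f v = ∑[ u < m ] f u v

-- The matrix unit at `(u , v)`, as a product so that its row and column sums factor.
cell : Fin m → Fin n → Matrix m n
cell u v x y = 𝟙 (x ≟ u) * 𝟙 (y ≟ v)

row-cell : (u : Fin m) (v : Fin n) → ∀ x → row (cell u v) x ≡ 𝟙 (x ≟ u)
row-cell {n = n} u v x = begin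
  ∑[ y < n ] (𝟙 (x ≟ u) * 𝟙 (y ≟ v)) ≡⟨ *-distribˡ-sum (𝟙 (x ≟ u)) (λ (y : Fin n) → 𝟙 (y ≟ v)) ⟨
  𝟙 (x ≟ u) * ∑[ y < n ] 𝟙 (y ≟ v)   ≡⟨ cong (𝟙 (x ≟ u) *_) (∑𝟙≟ v) ⟩
  𝟙 (x ≟ u) * 1                      ≡⟨ *-identityʳ _ ⟩
  𝟙 (x ≟ u)                          ∎
  where open ≡-Reasoning

col-cell : (u : Fin m) (v : Fin n) → ∀ y → col (cell u v) y ≡ 𝟙 (y ≟ v)
col-cell {m} u v y = begin
  ∑[ x < m ] (𝟙 (x ≟ u) * 𝟙 (y ≟ v)) ≡⟨ *-distribʳ-sum (𝟙 (y ≟ v)) (λ (x : Fin m) → 𝟙 (x ≟ u)) ⟨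
  (∑[ x < m ] 𝟙 (x ≟ u)) * 𝟙 (y ≟ v) ≡⟨ cong (_* 𝟙 (y ≟ v)) (∑𝟙≟ u) ⟩
  1 * 𝟙 (y ≟ v)                      ≡⟨ *-identityˡ _ ⟩
  𝟙 (y ≟ v)                          ∎
  where open ≡-Reasoning

cell-diag : (u : Fin m) (v : Fin n) → cell u v u v ≡ 1
cell-diag u v = cong₂ _*_ (𝟙-yes (u ≟ u) refl) (𝟙-yes (v ≟ v) refl)

cell-offRow : {u x : Fin m} (v : Fin n) → x ≢ u → ∀ y → cell u v x y ≡ 0
cell-offRow {u = u} {x} v x≢u y = cong (_* 𝟙 (y ≟ v)) (𝟙-no (x ≟ u) x≢u)

cell-offCol : (u x : Fin m) {v y : Fin n} → y ≢ v → cell u v x y ≡ 0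
cell-offCol u x {v} {y} y≢v = trans (cong (𝟙 (x ≟ u) *_) (𝟙-no (y ≟ v) y≢v)) (*-zeroʳ (𝟙 (x ≟ u)))

cell≤ : (f : Matrix m n) {u : Fin m} {v : Fin n} → 0 < f u v → ∀ x y → cell u v x y ≤ f x y
cell≤ f {u} {v} 0<fuv x y with x ≟ u | y ≟ v
... | yes refl | yes refl = 0<fuv
... | yes _    | no _     = z≤n
... | no _     | _        = z≤n

-- One unit of column v moves from row u′ to row u.
Moved : (u u′ : Fin m) (v : Fin n) (g g′ : Matrix m n) → Set
Moved u u′ v g g′ = ∀ x y → g′ x y + cell u′ v x y ≡ g x y + cell u v x y

move : ∀ u u′ v (g : Matrix m n) → 0 < g u′ v → ∃[ g′ ] Moved u u′ v g g′
-- The unit is added before one is taken away; as `g u′ v` is positive, the truncated subtraction is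
-- exact.
move u u′ v g 0<g = (λ x y → g x y + cell u v x y ∸ cell u′ v x y) ,
  λ x y → m∸n+n≡m (≤-trans (cell≤ g 0<g x y) (m≤m+n _ _))

module _ {u u′ : Fin m} {v : Fin n} {g g′ : Matrix m n} (mv : Moved u u′ v g g′) where

  row-moved : ∀ x → row g′ x + 𝟙 (x ≟ u′) ≡ row g x + 𝟙 (x ≟ u)
  row-moved x = begin
    row g′ x + 𝟙 (x ≟ u′)                ≡⟨ cong (row g′ x +_) (row-cell u′ v x) ⟨
    row g′ x + row (cell u′ v) x         ≡⟨ ∑-distrib-+ (g′ x) (cell u′ v x) ⟨
    ∑[ y < n ] (g′ x y + cell u′ v x y)  ≡⟨ sum-cong-≗ (mv x) ⟩
    ∑[ y < n ] (g x y + cell u v x y)    ≡⟨ ∑-distrib-+ (g x) (cell u v x) ⟩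
    row g x + row (cell u v) x           ≡⟨ cong (row g x +_) (row-cell u v x) ⟩
    row g x + 𝟙 (x ≟ u)                  ∎
    where open ≡-Reasoning

  col-moved : ∀ y → col g′ y ≡ col g y
  col-moved y = +-cancelʳ-≡ (𝟙 (y ≟ v)) _ _ (begin
    col g′ y + 𝟙 (y ≟ v)                 ≡⟨ cong (col g′ y +_) (col-cell u′ v y) ⟨
    col g′ y + col (cell u′ v) y         ≡⟨ ∑-distrib-+ (λ x → g′ x y) (λ x → cell u′ v x y) ⟨
    ∑[ x < m ] (g′ x y + cell u′ v x y)  ≡⟨ sum-cong-≗ (λ x → mv x y) ⟩
    ∑[ x < m ] (g x y + cell u v x y)    ≡⟨ ∑-distrib-+ (λ x → g x y) (λ x → cell u v x y) ⟩
    col g y + col (cell u v) y           ≡⟨ cong (col g y +_) (col-cell u v y) ⟩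
    col g y + 𝟙 (y ≟ v)                  ∎)
    where open ≡-Reasoning

  moved-≥ : ∀ {x} → x ≢ u′ → ∀ y → g x y ≤ g′ x y
  moved-≥ {x} x≢u′ y = begin
    g x y                   ≤⟨ m≤m+n _ _ ⟩
    g x y + cell u v x y    ≡⟨ mv x y ⟨
    g′ x y + cell u′ v x y  ≡⟨ cong (g′ x y +_) (cell-offRow v x≢u′ y) ⟩
    g′ x y + 0              ≡⟨ +-identityʳ _ ⟩
    g′ x y                  ∎
    where open ≤-Reasoning

  moved-≤ : ∀ {x} → x ≢ u → ∀ y → g′ x y ≤ g x y
  moved-≤ {x} x≢u y = begin
    g′ x y                  ≤⟨ m≤m+n _ _ ⟩
    g′ x y + cell u′ v x y  ≡⟨ mv x y ⟩
    g x y + cell u v x y    ≡⟨ cong (g x y +_) (cell-offRow v x≢u y) ⟩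
    g x y + 0               ≡⟨ +-identityʳ _ ⟩
    g x y                   ∎
    where open ≤-Reasoning

  moved-≡ : ∀ {x} → x ≢ u → x ≢ u′ → ∀ y → g′ x y ≡ g x y
  moved-≡ x≢u x≢u′ y = ≤-antisym (moved-≤ x≢u y) (moved-≥ x≢u′ y)

  moved-offCol : ∀ x {y} → y ≢ v → g′ x y ≡ g x y
  moved-offCol x {y} y≢v = begin
    g′ x y                  ≡⟨ +-identityʳ _ ⟨
    g′ x y + 0              ≡⟨ cong (g′ x y +_) (cell-offCol u′ x y≢v) ⟨
    g′ x y + cell u′ v x y  ≡⟨ mv x y ⟩
    g x y + cell u v x y    ≡⟨ cong (g x y +_) (cell-offCol u x y≢v) ⟩
    g x y + 0               ≡⟨ +-identityʳ _ ⟩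
    g x y                   ∎
    where open ≡-Reasoning

  moved-supp : ∀ x y → 0 < g′ x y → 0 < g x y ⊎ (x ≡ u × y ≡ v)
  moved-supp x y 0<g′ with x ≟ u | y ≟ v
  ... | yes p  | yes p′ = inj₂ (p , p′)
  ... | no x≢u | _      = inj₁ (<-≤-trans 0<g′ (moved-≤ x≢u y))
  ... | yes _  | no y≢v = inj₁ (subst (0 <_) (moved-offCol x y≢v) 0<g′)

  moved-corner : u′ ≢ u → suc (g′ u′ v) ≡ g u′ v
  moved-corner u′≢u = begin
    suc (g′ u′ v)             ≡⟨ +-comm 1 _ ⟩
    g′ u′ v + 1               ≡⟨ cong (g′ u′ v +_) (cell-diag u′ v) ⟨
    g′ u′ v + cell u′ v u′ v  ≡⟨ mv u′ v ⟩
    g u′ v + cell u v u′ v    ≡⟨ cong (g u′ v +_) (cell-offRow v u′≢u v) ⟩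
    g u′ v + 0                ≡⟨ +-identityʳ _ ⟩
    g u′ v                    ∎
    where open ≡-Reasoning

∑𝟙∈* : (p : Subset n) (c : ℕ) → ∑[ i < n ] (𝟙 (i ∈? p) * c) ≡ c * ∣ p ∣
∑𝟙∈* {n} p c = begin
  ∑[ i < n ] (𝟙 (i ∈? p) * c)  ≡⟨ *-distribʳ-sum c (λ (i : Fin n) → 𝟙 (i ∈? p)) ⟨
  (∑[ i < n ] 𝟙 (i ∈? p)) * c  ≡⟨ cong (_* c) (∣p∣≡∑ p) ⟨
  ∣ p ∣ * c                    ≡⟨ *-comm ∣ p ∣ c ⟩
  c * ∣ p ∣                    ∎
  where open ≡-Reasoning

-- Hall's theorem with demands d on the left and capacities q on the right

module Hall {m n : ℕ} (G : BipartiteGraph m n) (q d : ℕ)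
            (expand : ∀ S → d * ∣ S ∣ ≤ q * ∣ Γ G S ∣) where

  record Flow (f : Matrix m n) : Set where
    field
      supp : ∀ {u v} → 0 < f u v → v ∈ G u
      cap  : ∀ v → col f v ≤ q

  open Flow

  -- Stands in for an augmenting path from `u`. `grows` confines every loss to the rows of `R`, so
  -- the path can be prolonged through any row outside `R`.
  record Augmentable (R : Subset m) (f : Matrix m n) (u : Fin m) : Set where
    field
      f′    : Matrix m n
      flow  : Flow f′
      row′  : ∀ x → row f′ x ≡ row f x + 𝟙 (x ≟ u)
      grows : ∀ {x} → x ∉ R → ∀ y → f x y ≤ f′ x y

  augment-slack : ∀ {f R u v} → Flow f → v ∈ G u → col f v < q → Augmentable R f u
  augment-slack {f} {R} {u} {v} fl v∈Gu slack = record
    { f′    = λ x y → f x y + cell u v x y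
    ; flow  = record { supp = supp′ ; cap = cap′ }
    ; row′  = λ x → trans (∑-distrib-+ (f x) (cell u v x)) (cong (row f x +_) (row-cell u v x))
    ; grows = λ _ y → m≤m+n _ _
    }
    where
    supp′ : ∀ {x y} → 0 < f x y + cell u v x y → y ∈ G x
    supp′ {x} {y} 0<f with x ≟ u | y ≟ v
    ... | yes refl | yes refl = v∈Gu
    ... | yes refl | no _     = supp fl (subst (0 <_) (+-identityʳ _) 0<f)
    ... | no _     | _        = supp fl (subst (0 <_) (+-identityʳ _) 0<f)

    cap′ : ∀ y → ∑[ x < m ] (f x y + cell u v x y) ≤ q
    cap′ y = begin
      ∑[ x < m ] (f x y + cell u v x y)  ≡⟨ ∑-distrib-+ (λ x → f x y) (λ x → cell u v x y) ⟩
      col f y + col (cell u v) y         ≡⟨ cong (col f y +_) (col-cell u v y) ⟩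
      col f y + 𝟙 (y ≟ v)                ≤⟨ bound ⟩
      q                                  ∎
      where
      open ≤-Reasoning
      bound : col f y + 𝟙 (y ≟ v) ≤ q
      bound with y ≟ v
      ... | yes refl = ≤-trans (≤-reflexive (+-comm _ 1)) slack
      ... | no _     = ≤-trans (≤-reflexive (+-identityʳ _)) (cap fl y)

  -- Augment `u′` first, then hand one unit of column `v` from `u′` to `u`. That unit is still there
  -- because rows outside `R′` have not lost anything; `u′` returns to its old sum, and it is the
  -- only further row that may lose entries.
  augment-via : ∀ {f R R′ u u′ v} → v ∈ G u → R′ ⊆ R → u′ ∈ R → u′ ∉ R′ → 0 < f u′ v →
                Augmentable R′ f u′ → Augmentable R f u
  augment-via {f} {R} {R′} {u} {u′} {v} v∈Gu R′⊆R u′∈R u′∉R′ 0<f aug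
    with move u u′ v f₁ (<-≤-trans 0<f (grows u′∉R′ v))
    where open Augmentable aug renaming (f′ to f₁)
  ... | f₂ , mv = record
    { f′    = f₂
    ; flow  = record { supp = supp′ ; cap = λ y → ≤-trans (≤-reflexive (col-moved mv y)) (cap flow y) }
    ; row′  = λ x → +-cancelʳ-≡ (𝟙 (x ≟ u′)) _ _ (begin
        row f₂ x + 𝟙 (x ≟ u′)              ≡⟨ row-moved mv x ⟩
        row f₁ x + 𝟙 (x ≟ u)               ≡⟨ cong (_+ 𝟙 (x ≟ u)) (row′ x) ⟩
        row f x + 𝟙 (x ≟ u′) + 𝟙 (x ≟ u)   ≡⟨ +-assoc (row f x) _ _ ⟩
        row f x + (𝟙 (x ≟ u′) + 𝟙 (x ≟ u)) ≡⟨ cong (row f x +_) (+-comm (𝟙 (x ≟ u′)) _) ⟩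
        row f x + (𝟙 (x ≟ u) + 𝟙 (x ≟ u′)) ≡⟨ +-assoc (row f x) _ _ ⟨
        row f x + 𝟙 (x ≟ u) + 𝟙 (x ≟ u′)   ∎)
    ; grows = λ x∉R y → ≤-trans (grows (x∉R ∘ R′⊆R) y) (moved-≥ mv (λ { refl → x∉R u′∈R }) y)
    }
    where
    open Augmentable aug renaming (f′ to f₁)
    open ≡-Reasoning
    supp′ : ∀ {x y} → 0 < f₂ x y → y ∈ G x
    supp′ {x} {y} 0<f₂ with moved-supp mv x y 0<f₂
    ... | inj₁ 0<f₁         = supp flow 0<f₁
    ... | inj₂ (refl , refl) = v∈Gu

  -- `R′` plays the part of the rows found before `x`, so that prolonging a path through `x` never
  -- meets `x` again.
  Augmenting : Matrix m n → Subset m → Set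
  Augmenting f R = ∀ {x} → x ∈ R → ∃[ R′ ] (R′ ⊆ R × x ∉ R′ × Augmentable R′ f x)

  Extends : Matrix m n → Subset m → Fin m → Set
  Extends f R u = u ∉ R × ∃[ v ] (v ∈ G u × (col f v < q ⊎ ∃[ u′ ] (u′ ∈ R × 0 < f u′ v)))

  extends? : ∀ f R → Decidable (Extends f R)
  extends? f R u = ¬? (u ∈? R) ×-dec any? λ v → (v ∈? G u) ×-dec
    ((col f v <? q) ⊎-dec any? λ u′ → (u′ ∈? R) ×-dec (0 <? f u′ v))

  -- A search backwards from columns with slack, along edges that carry flow. `N` bounds the rows
  -- not yet found.
  saturate : ∀ {f} → Flow f → ∀ N R → ∣ ∁ R ∣ ≤ N → Augmenting f R →
             ∃[ R′ ] (Augmenting f R′ × (∀ u → ¬ Extends f R′ u))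
  saturate {f} fl N R ∣∁R∣≤N aug with any? (extends? f R)
  ... | no ¬ext = R , aug , λ u ext → ¬ext (u , ext)
  saturate {f} fl zero R ∣∁R∣≤N aug | yes (u , u∉R , _) =
    contradiction (<-≤-trans (∣∁[p∪⁅x⁆]∣<∣∁p∣ R u∉R) ∣∁R∣≤N) λ ()
  saturate {f} fl (suc N) R ∣∁R∣≤N aug | yes (u , u∉R , v , v∈Gu , source) =
    saturate fl N (R ∪ ⁅ u ⁆) (s≤s⁻¹ (<-≤-trans (∣∁[p∪⁅x⁆]∣<∣∁p∣ R u∉R) ∣∁R∣≤N)) aug′
    where
    new : col f v < q ⊎ ∃[ u′ ] (u′ ∈ R × 0 < f u′ v) → Augmentable R f u
    new (inj₁ slack)              = augment-slack fl v∈Gu slack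
    new (inj₂ (u′ , u′∈R , 0<f)) with aug u′∈R
    ... | R′ , R′⊆R , u′∉R′ , a = augment-via v∈Gu R′⊆R u′∈R u′∉R′ 0<f a

    aug′ : Augmenting f (R ∪ ⁅ u ⁆)
    aug′ x∈ with x∈p∪q⁻ R ⁅ u ⁆ x∈
    ... | inj₂ x∈⁅u⁆ rewrite x∈⁅y⁆⇒x≡y u x∈⁅u⁆ = R , p⊆p∪q ⁅ u ⁆ , u∉R , new source
    ... | inj₁ x∈R with aug x∈R
    ...   | R′ , R′⊆R , x∉R′ , a = R′ , p⊆p∪q ⁅ u ⁆ ∘ R′⊆R , x∉R′ , a

  -- Otherwise S = ∁ R violates expansion: its neighbours are saturated, and
  -- all their flow comes from S.
  stuck⇒∈ : ∀ {f R} → Flow f → (∀ u → ¬ Extends f R u) → (∀ u → row f u ≤ d) →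
            ∀ {u} → row f u < d → u ∈ R
  stuck⇒∈ {f} {R} fl stuck row≤d {u} row<d with u ∈? R
  ... | yes u∈R = u∈R
  ... | no u∉R = contradiction (expand S) (<⇒≱ (begin-strict
    q * ∣ Γ G S ∣                                    ≡⟨ ∑𝟙∈* (Γ G S) q ⟨
    ∑[ v < n ] (𝟙 (v ∈? Γ G S) * q)                  ≤⟨ ∑-mono (λ v → 𝟙*-mono (v ∈? Γ G S) (saturated v)) ⟩
    ∑[ v < n ] (𝟙 (v ∈? Γ G S) * col f v)            ≡⟨ sum-cong-≗ (λ v →
                                                          *-distribˡ-sum (𝟙 (v ∈? Γ G S)) (λ (u : Fin m) → f u v)) ⟩
    ∑[ v < n ] ∑[ u < m ] (𝟙 (v ∈? Γ G S) * f u v)   ≤⟨ ∑-mono (λ v → ∑-mono λ u → 𝟙*-≤ (v ∈? Γ G S) (fromS u v)) ⟩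
    ∑[ v < n ] ∑[ u < m ] (𝟙 (u ∈? S) * f u v)       ≡⟨ ∑-comm (λ v u → 𝟙 (u ∈? S) * f u v) ⟩
    ∑[ u < m ] ∑[ v < n ] (𝟙 (u ∈? S) * f u v)       ≡⟨ sum-cong-≗ (λ u → *-distribˡ-sum (𝟙 (u ∈? S)) (f u)) ⟨
    ∑[ u < m ] (𝟙 (u ∈? S) * row f u)                <⟨ ∑-mono-< (λ u →
                                                          *-monoʳ-≤ (𝟙 (u ∈? S)) (row≤d u)) u strict-u ⟩
    ∑[ u < m ] (𝟙 (u ∈? S) * d)                      ≡⟨ ∑𝟙∈* S d ⟩
    d * ∣ S ∣                                        ∎))
    where
    open ≤-Reasoning
    S = ∁ R
    Γ⁻ : ∀ {v} → v ∈ Γ G S → ∃[ u ] (u ∈ S × v ∈ G u)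
    Γ⁻ = ∈⟪⟫⁻ λ v → any? λ u → (u ∈? S) ×-dec (v ∈? G u)

    saturated : ∀ v → v ∈ Γ G S → q ≤ col f v
    saturated v v∈Γ with Γ⁻ v∈Γ
    ... | u , u∈S , v∈Gu = ≮⇒≥ λ slack → stuck u (x∈∁p⇒x∉p u∈S , v , v∈Gu , inj₁ slack)

    fromS : ∀ u v → v ∈ Γ G S → f u v ≤ 𝟙 (u ∈? S) * f u v
    fromS u v v∈Γ with u ∈? S
    ... | yes _ = ≤-reflexive (sym (*-identityˡ _))
    ... | no u∉S with Γ⁻ v∈Γ
    ...   | w , w∈S , v∈Gw = ≮⇒≥ λ 0<f → stuck w
      (x∈∁p⇒x∉p w∈S , v , v∈Gw , inj₂ (u , x∉∁p⇒x∈p u∉S , 0<f))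

    -- The deficient row `u` lies in `S` itself, and it alone makes the inequality strict.
    strict-u : 𝟙 (u ∈? S) * row f u < 𝟙 (u ∈? S) * d
    strict-u rewrite 𝟙-yes (u ∈? S) (x∉p⇒x∈∁p u∉R) = +-monoˡ-< 0 row<d

  Saturating : Matrix m n → Set
  Saturating f = Flow f × (∀ u → row f u ≡ d)

  -- By `stuck⇒∈` a search from the empty set reaches every deficient row, so one of them can gain a
  -- unit. `N` bounds the total deficit.
  fill : ∀ N {f} → Flow f → (∀ u → row f u ≤ d) → ∑[ u < m ] (d ∸ row f u) ≤ N →
         ∃[ g ] Saturating g
  fill N {f} fl row≤d missing with any? (λ u → row f u <? d)
  ... | no ¬row<d = f , fl , λ u → ≤-antisym (row≤d u) (≮⇒≥ λ row<d → ¬row<d (u , row<d))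
  ... | yes (u , row<d) with saturate fl _ ⊥ ≤-refl (λ x∈⊥ → contradiction x∈⊥ ∉⊥)
  ...   | R , aug , stuck with aug (stuck⇒∈ fl stuck row≤d row<d)
  ...     | _ , _ , _ , a = step N missing
    where
    open Augmentable a
    row-u : row f′ u ≡ suc (row f u)
    row-u = trans (row′ u) (trans (cong (row f u +_) (𝟙-yes (u ≟ u) refl)) (+-comm _ 1))

    row′≤d : ∀ x → row f′ x ≤ d
    row′≤d x with x ≟ u
    ... | yes refl = subst (_≤ d) (sym row-u) row<d
    ... | no x≢u   = subst (_≤ d) (sym (trans (row′ x)
      (trans (cong (row f x +_) (𝟙-no (x ≟ u) x≢u)) (+-identityʳ _)))) (row≤d x)

    fewer : ∑[ x < m ] (d ∸ row f′ x) < ∑[ x < m ] (d ∸ row f x)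
    fewer = ∑-mono-< (λ x → ∸-monoʳ-≤ d (subst (row f x ≤_) (sym (row′ x)) (m≤m+n _ _))) u
      (∸-monoʳ-< (subst (row f u <_) (sym row-u) ≤-refl) (row′≤d u))

    step : ∀ N → ∑[ u < m ] (d ∸ row f u) ≤ N → ∃[ g ] Saturating g
    step zero    ≤N = contradiction (<-≤-trans fewer ≤N) λ ()
    step (suc N) ≤N = fill N flow row′≤d (s≤s⁻¹ (<-≤-trans fewer ≤N))

  saturating : ∃[ g ] Saturating g
  saturating = fill _ {λ _ _ → 0} (record { supp = λ () ; cap = λ v → subst (_≤ q) (sym (∑0 m)) z≤n })
    (λ u → subst (_≤ d) (sym (∑0 n)) z≤n) ≤-refl

-- Rearranging a matrix into one whose support is a forest

Φ : Matrix m n → ℕ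
Φ {m} {n} f = ∑[ u < m ] ∑[ v < n ] (f u v * f u v)

record Rearranged (f g : Matrix m n) : Set where
  field
    supp⊆ : ∀ {u v} → 0 < g u v → 0 < f u v
    row≡  : ∀ u → row g u ≡ row f u
    col≡  : ∀ v → col g v ≡ col f v

open Rearranged

rearranged-refl : {f : Matrix m n} → Rearranged f f
rearranged-refl = record { supp⊆ = λ 0<f → 0<f ; row≡ = λ _ → refl ; col≡ = λ _ → refl }

rearranged-trans : {f g h : Matrix m n} → Rearranged f g → Rearranged g h → Rearranged f h
rearranged-trans fg gh = record
  { supp⊆ = supp⊆ fg ∘ supp⊆ gh
  ; row≡  = λ u → trans (row≡ gh u) (row≡ fg u)
  ; col≡  = λ v → trans (col≡ gh v) (col≡ fg v)
  }

Better : Matrix m n → Set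
Better f = ∃[ g ] (Rearranged f g × Φ f < Φ g)

-- Ranks r on U and s on V witnessing that the support of f restricted to S is a forest.
record Ranking (f : Matrix m n) (S : Subset m) : Set where
  field
    r : Fin m → ℕ
    s : Fin n → ℕ
    r≢s : ∀ {u v} → u ∈ S → 0 < f u v → r u ≢ s v
    uniqueʳ : ∀ {u v v′} → u ∈ S → 0 < f u v → 0 < f u v′ → r u < s v → r u < s v′ → v ≡ v′
    uniqueˡ : ∀ {u u′ v} → u ∈ S → u′ ∈ S → 0 < f u v → 0 < f u′ v → s v < r u → s v < r u′ → u ≡ u′

-- With `t = c ∸ a` the summands are `c - t` and `c + t`: the cross terms cancel and `2 t²` remains.
squares-≡ : ∀ {a b c} → a ≤ c → a + b ≡ c + c → a * a + b * b ≡ c * c + c * c + 2 * ((c ∸ a) * (c ∸ a))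
squares-≡ {a} {b} {c} a≤c a+b≡2c
  rewrite sym (m+[n∸m]≡n a≤c) | m+n∸m≡n a (c ∸ a)
        | +-cancelˡ-≡ a b (c ∸ a + (a + (c ∸ a))) (trans a+b≡2c (+-assoc a _ _)) = identity a (c ∸ a)
  where
  identity : ∀ a t → a * a + (t + (a + t)) * (t + (a + t)) ≡ (a + t) * (a + t) + (a + t) * (a + t) + 2 * (t * t)
  identity = solve-∀

squares-≤ : ∀ {a b c} → a + b ≡ c + c → c * c + c * c ≤ a * a + b * b
squares-≤ {a} {b} {c} a+b≡2c with ≤-total a c
... | inj₁ a≤c = ≤-trans (m≤m+n _ _) (≤-reflexive (sym (squares-≡ a≤c a+b≡2c)))
... | inj₂ c≤a = ≤-trans (m≤m+n _ _)
  (≤-reflexive (trans (sym (squares-≡ b≤c b+a≡2c)) (+-comm (b * b) (a * a))))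
  where
  b+a≡2c = trans (+-comm b a) a+b≡2c
  b≤c : b ≤ c
  b≤c = +-cancelˡ-≤ a b c (≤-trans (≤-reflexive a+b≡2c) (+-monoˡ-≤ c c≤a))

squares-< : ∀ {a b c} → a < c → a + b ≡ c + c → c * c + c * c < a * a + b * b
squares-< {a} {b} {c} a<c a+b≡2c rewrite squares-≡ (<⇒≤ a<c) a+b≡2c =
  m<m+n (c * c + c * c) (*-mono-< {0} {2} (s≤s z≤n) (*-mono-< {0} (m<n⇒0<n∸m a<c) (m<n⇒0<n∸m a<c)))

∑∑-distrib-+ : (f g : Matrix m n) →
  ∑[ u < m ] ∑[ v < n ] (f u v + g u v) ≡ ∑[ u < m ] ∑[ v < n ] f u v + ∑[ u < m ] ∑[ v < n ] g u v
∑∑-distrib-+ {m} {n} f g = trans (sum-cong-≗ (λ u → ∑-distrib-+ (f u) (g u))) (∑-distrib-+ (row f) (row g))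

-- `f` is the midpoint of `f⁺` and `f⁻` and differs from them somewhere, so by strict convexity `Φ`
-- is larger at one of the two. A positive entry in either forces a positive entry in the midpoint,
-- hence the support does not grow.
improve : {f f⁺ f⁻ : Matrix m n} → (∀ x y → f⁺ x y + f⁻ x y ≡ f x y + f x y) →
          (∀ x → row f⁺ x ≡ row f x) → (∀ y → col f⁺ y ≡ col f y) →
          ∀ {u v} → f⁺ u v < f u v → Better f
improve {m} {n} {f} {f⁺} {f⁻} balance row⁺ col⁺ {u} {v} f⁺<f = pick (Φ f <? Φ f⁺) (Φ f <? Φ f⁻)
  where
  complement : ∀ {a b c} → a + b ≡ c + c → a ≡ c → b ≡ c
  complement {a} {b} {c} a+b≡2c refl = +-cancelˡ-≡ a b c a+b≡2c

  half : ∀ {a b c} → a + b ≡ c + c → 0 < a ⊎ 0 < b → 0 < c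
  half {c = suc c} _ _ = s≤s z≤n
  half {suc a} {b} {zero} () _
  half {zero} {.0} {zero} refl (inj₁ ())
  half {zero} {.0} {zero} refl (inj₂ ())

  re⁺ : Rearranged f f⁺
  re⁺ = record { supp⊆ = λ {x} {y} 0<f⁺ → half (balance x y) (inj₁ 0<f⁺) ; row≡ = row⁺ ; col≡ = col⁺ }

  re⁻ : Rearranged f f⁻
  re⁻ = record
    { supp⊆ = λ {x} {y} 0<f⁻ → half (balance x y) (inj₂ 0<f⁻)
    ; row≡  = λ x → complement (trans (sym (∑-distrib-+ (f⁺ x) (f⁻ x)))
                (trans (sum-cong-≗ (balance x)) (∑-distrib-+ (f x) (f x)))) (row⁺ x)
    ; col≡  = λ y → complement (trans (sym (∑-distrib-+ (λ x → f⁺ x y) (λ x → f⁻ x y)))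
                (trans (sum-cong-≗ (λ x → balance x y)) (∑-distrib-+ (λ x → f x y) (λ x → f x y)))) (col⁺ y)
    }

  Φ+Φ< : Φ f + Φ f < Φ f⁺ + Φ f⁻
  Φ+Φ< = begin-strict
    Φ f + Φ f ≡⟨ ∑∑-distrib-+ (λ x y → f x y * f x y) (λ x y → f x y * f x y) ⟨
    ∑[ x < m ] ∑[ y < n ] (f x y * f x y + f x y * f x y)
      <⟨ ∑-mono-< (λ x → ∑-mono (sq x)) u (∑-mono-< (sq u) v (squares-< f⁺<f (balance u v))) ⟩
    ∑[ x < m ] ∑[ y < n ] (f⁺ x y * f⁺ x y + f⁻ x y * f⁻ x y)
      ≡⟨ ∑∑-distrib-+ (λ x y → f⁺ x y * f⁺ x y) (λ x y → f⁻ x y * f⁻ x y) ⟩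
    Φ f⁺ + Φ f⁻ ∎
    where
    open ≤-Reasoning
    sq : ∀ x y → f x y * f x y + f x y * f x y ≤ f⁺ x y * f⁺ x y + f⁻ x y * f⁻ x y
    sq x y = squares-≤ {f⁺ x y} {f⁻ x y} {f x y} (balance x y)

  pick : Dec (Φ f < Φ f⁺) → Dec (Φ f < Φ f⁻) → Better f
  pick (yes Φ<) _ = f⁺ , re⁺ , Φ<
  pick (no _) (yes Φ<) = f⁻ , re⁻ , Φ<
  pick (no ≮⁺) (no ≮⁻) = contradiction (+-mono-≤ (≮⇒≥ ≮⁺) (≮⇒≥ ≮⁻)) (<⇒≱ Φ+Φ<)

-- Walks in the support that either yield a ranking or close a cycle

module Rank {m n : ℕ} (f : Matrix m n) where

  Other : Subset m → Fin m → Fin n → Set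
  Other S u v = ∃[ u′ ] (u′ ∈ S × u′ ≢ u × 0 < f u′ v)

  other? : ∀ S u v → Dec (Other S u v)
  other? S u v = any? λ u′ → (u′ ∈? S) ×-dec ¬? (u′ ≟ u) ×-dec (0 <? f u′ v)

  Shared : Subset m → Fin m → Fin n → Set
  Shared S u v = 0 < f u v × Other S u v

  shared? : ∀ S u v → Dec (Shared S u v)
  shared? S u v = (0 <? f u v) ×-dec other? S u v

  -- A branching row can be left by a shared column other than the one of arrival. A row that is not
  -- branching meets the rest of `S` in at most one column, like a leaf.
  Branching : Subset m → Fin m → Set
  Branching S u = ∃[ v ] ∃[ v′ ] (Shared S u v × Shared S u v′ × v ≢ v′)

  branching? : ∀ S u → Dec (Branching S u)
  branching? S u = any? λ v → any? λ v′ → shared? S u v ×-dec shared? S u v′ ×-dec ¬? (v ≟ v′)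

  branch : ∀ {S u} → Branching S u → ∀ v → ∃[ v′ ] (v′ ≢ v × Shared S u v′)
  branch (v₁ , v₂ , sh₁ , sh₂ , v₁≢v₂) v with v₁ ≟ v
  ... | yes refl = v₂ , v₁≢v₂ ∘ sym , sh₂
  ... | no v₁≢v  = v₁ , v₁≢v , sh₁

  -- A walk from w to u has been used to push f⁺ − f = f − f⁻ towards a cycle;
  -- only rows w and u are still out of balance.
  record Shift (T : Subset m) (w u : Fin m) : Set where
    field
      f⁺ f⁻   : Matrix m n
      balance : ∀ x y → f⁺ x y + f⁻ x y ≡ f x y + f x y
      row⁺    : ∀ x → row f⁺ x + 𝟙 (x ≟ u) ≡ row f x + 𝟙 (x ≟ w)
      col⁺    : ∀ y → col f⁺ y ≡ col f y
      start   : ∀ y → f w y ≤ f⁺ w y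
      end     : ∀ y → f⁺ u y ≤ f u y
      outside≡ : ∀ {x} → x ∉ T → ∀ y → f⁺ x y ≡ f x y

  open Shift

  still : ∀ T u → Shift T u u
  still T u = record
    { f⁺ = f ; f⁻ = f ; balance = λ _ _ → refl ; row⁺ = λ _ → refl ; col⁺ = λ _ → refl
    ; start = λ _ → ≤-refl ; end = λ _ → ≤-refl ; outside≡ = λ _ _ → refl }

  module _ {T w u} (sh : Shift T w u) {u′ v} (u′≢u : u′ ≢ u) (0<fuv : 0 < f u v) (0<f⁺u′v : 0 < f⁺ sh u′ v) where

    private
      -- Row `u` has not grown in `f⁺`, so by `balance` it has not shrunk in `f⁻`, which therefore
      -- has a unit to move out of it.
      0<f⁻uv : 0 < f⁻ sh u v
      0<f⁻uv = <-≤-trans 0<fuv (+-cancelˡ-≤ (f u v) _ _ (≤-trans (≤-reflexive (sym (balance sh u v)))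
        (+-monoˡ-≤ (f⁻ sh u v) (end sh v))))

      next⁺ = move u u′ v (f⁺ sh) 0<f⁺u′v
      next⁻ = move u′ u v (f⁻ sh) 0<f⁻uv
      g⁺ = proj₁ next⁺
      g⁻ = proj₁ next⁻
      mv⁺ = proj₂ next⁺
      mv⁻ = proj₂ next⁻

      balance′ : ∀ x y → g⁺ x y + g⁻ x y ≡ f x y + f x y
      balance′ x y = trans (+-cancelʳ-≡ (cell u′ v x y + cell u v x y) _ _ (begin
        g⁺ x y + g⁻ x y + (cell u′ v x y + cell u v x y)          ≡⟨ interchange (g⁺ x y) _ _ _ ⟩
        g⁺ x y + cell u′ v x y + (g⁻ x y + cell u v x y)          ≡⟨ cong₂ _+_ (mv⁺ x y) (mv⁻ x y) ⟩
        f⁺ sh x y + cell u v x y + (f⁻ sh x y + cell u′ v x y)    ≡⟨ interchange (f⁺ sh x y) _ _ _ ⟨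
        f⁺ sh x y + f⁻ sh x y + (cell u v x y + cell u′ v x y)    ≡⟨ cong (f⁺ sh x y + f⁻ sh x y +_)
                                                                       (+-comm (cell u v x y) _) ⟩
        f⁺ sh x y + f⁻ sh x y + (cell u′ v x y + cell u v x y)    ∎)) (balance sh x y)
        where
        open ≡-Reasoning
        interchange : ∀ a b c d → a + b + (c + d) ≡ a + c + (b + d)
        interchange = solve-∀

      row′ : ∀ x → row g⁺ x + 𝟙 (x ≟ u′) ≡ row f x + 𝟙 (x ≟ w)
      row′ x = trans (row-moved mv⁺ x) (row⁺ sh x)

      col′ : ∀ y → col g⁺ y ≡ col f y
      col′ y = trans (col-moved mv⁺ y) (col⁺ sh y)

    -- Back at the start `w`, the two imbalances in `row⁺` cancel. The last move touches only column
    -- `v`, so the deficit at `v₀` survives and shows that the shift is not trivial.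
    close : u′ ≡ w → ∀ {v₀} → v ≢ v₀ → f⁺ sh u v₀ < f u v₀ → Better f
    close refl {v₀} v≢v₀ f⁺<f = improve balance′ (λ x → +-cancelʳ-≡ (𝟙 (x ≟ u′)) _ _ (row′ x)) col′
      (subst (_< f u v₀) (sym (moved-offCol mv⁺ u (v≢v₀ ∘ sym))) f⁺<f)

    -- Row `u′` is still that of `f`, so the unit taken from it leaves a deficit in the column of
    -- arrival `v`. This is the deficit that `close` asks for when the walk leaves by another
    -- column.
    extend : u ∈ T → w ∈ T → u′ ∉ T → Σ[ sh′ ∈ Shift (T ∪ ⁅ u′ ⁆) w u′ ] f⁺ sh′ u′ v < f u′ v
    extend u∈T w∈T u′∉T = record
      { f⁺ = g⁺ ; f⁻ = g⁻ ; balance = balance′ ; row⁺ = row′ ; col⁺ = col′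
      ; start   = λ y → ≤-trans (start sh y) (moved-≥ mv⁺ (λ { refl → u′∉T w∈T }) y)
      ; end     = λ y → ≤-trans (moved-≤ mv⁺ u′≢u y) (≤-reflexive (outside≡ sh u′∉T y))
      ; outside≡ = λ x∉ y → trans
          (moved-≡ mv⁺ (λ { refl → x∉ (p⊆p∪q ⁅ u′ ⁆ u∈T) }) (λ { refl → x∉ (q⊆p∪q T ⁅ u′ ⁆ (x∈⁅x⁆ u′)) }) y)
          (outside≡ sh (x∉ ∘ p⊆p∪q ⁅ u′ ⁆) y)
      } , subst (g⁺ u′ v <_) (outside≡ sh u′∉T v) (≤-reflexive (moved-corner mv⁺ u′≢u))

  -- The walk may close at any visited row, so a shift from each of them is kept. `v₀` is the column
  -- of arrival at `u`; the shift from `u` to itself owes no deficit there.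
  Shifts : Subset m → Fin m → Fin n → Set
  Shifts T u v₀ = ∀ {w} → w ∈ T → Σ[ sh ∈ Shift T w u ] (w ≢ u → f⁺ sh u v₀ < f u v₀)

  -- Leave `u` by a shared column other than `v₀`. If the next row was visited before, the shift
  -- from it closes up; otherwise the walk goes on, and `N` bounds the unvisited rows.
  walk : ∀ {S} → (∀ {u} → u ∈ S → Branching S u) →
         ∀ N T u v₀ → ∣ ∁ T ∣ ≤ N → u ∈ S → u ∈ T → Shifts T u v₀ → Better f
  walk {S} branching N T u v₀ ∣∁T∣≤N u∈S u∈T shifts with branch (branching u∈S) v₀
  ... | v , v≢v₀ , 0<fuv , u′ , u′∈S , u′≢u , 0<fu′v = go N ∣∁T∣≤N (u′ ∈? T)
    where
    go : ∀ N → ∣ ∁ T ∣ ≤ N → Dec (u′ ∈ T) → Better f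
    go N _ (yes u′∈T) with shifts u′∈T
    ... | sh , f⁺<f = close sh u′≢u 0<fuv (<-≤-trans 0<fu′v (start sh v)) refl v≢v₀ (f⁺<f u′≢u)
    go zero ∣∁T∣≤N (no u′∉T) = contradiction (<-≤-trans (∣∁[p∪⁅x⁆]∣<∣∁p∣ T u′∉T) ∣∁T∣≤N) λ ()
    go (suc N) ∣∁T∣≤N (no u′∉T) =
      walk branching N (T ∪ ⁅ u′ ⁆) u′ v (s≤s⁻¹ (<-≤-trans (∣∁[p∪⁅x⁆]∣<∣∁p∣ T u′∉T) ∣∁T∣≤N)) u′∈S
        (q⊆p∪q T ⁅ u′ ⁆ (x∈⁅x⁆ u′)) shifts′
      where
      shifts′ : Shifts (T ∪ ⁅ u′ ⁆) u′ v
      shifts′ w∈ with x∈p∪q⁻ T ⁅ u′ ⁆ w∈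
      ... | inj₂ w∈⁅u′⁆ rewrite x∈⁅y⁆⇒x≡y u′ w∈⁅u′⁆ = still _ u′ , contradiction refl
      ... | inj₁ w∈T with shifts w∈T
      ...   | sh , _ with extend sh u′≢u 0<fuv (subst (0 <_) (sym (outside≡ sh u′∉T v)) 0<fu′v) u∈T w∈T u′∉T
      ...     | sh′ , f⁺<f = sh′ , λ _ → f⁺<f

  walk-from : ∀ {S u} → (∀ {u} → u ∈ S → Branching S u) → u ∈ S → Better f
  walk-from {S} {u} branching u∈S =
    -- Nothing has been traversed yet, so any column can serve as the column of arrival.
    walk branching _ ⁅ u ⁆ u (proj₁ (branching u∈S)) ≤-refl u∈S (x∈⁅x⁆ u) shifts
    where
    shifts : Shifts ⁅ u ⁆ u (proj₁ (branching u∈S))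
    shifts w∈ rewrite x∈⁅y⁆⇒x≡y u w∈ = still _ u , contradiction refl

  -- u gets a rank below all others except those of its unshared neighbours.
  prepend : ∀ {S u} → u ∈ S → ¬ Branching S u → Ranking f (S - u) → Ranking f S
  prepend {S} {u} u∈S ¬br R = record
    { r = r′ ; s = s′ ; r≢s = r≢s′ ; uniqueʳ = uniqueʳ′ ; uniqueˡ = uniqueˡ′ }
    where
    open Ranking R
    -- Lifting the old ranks by 2 frees 1 for `u` and 0 for the columns that no other row of `S`
    -- meets. What remains above `u` is its shared columns, at most one.
    r′ : Fin m → ℕ
    r′ x with x ≟ u
    ... | yes _ = 1
    ... | no _  = 2 + r x

    s′ : Fin n → ℕ
    s′ v with other? S u v
    ... | yes _ = 2 + s v
    ... | no _  = 0

    in- : ∀ {x} → x ∈ S → x ≢ u → x ∈ S - u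
    in- = x∈p∧x≢y⇒x∈p-y

    r≢s′ : ∀ {x v} → x ∈ S → 0 < f x v → r′ x ≢ s′ v
    r≢s′ {x} {v} x∈S 0<f eq with x ≟ u | other? S u v
    ... | no x≢u | no ¬oth = ¬oth (x , x∈S , x≢u , 0<f)
    ... | no x≢u | yes _   = r≢s (in- x∈S x≢u) 0<f (suc-injective (suc-injective eq))

    uniqueʳ′ : ∀ {x v v′} → x ∈ S → 0 < f x v → 0 < f x v′ → r′ x < s′ v → r′ x < s′ v′ → v ≡ v′
    uniqueʳ′ {x} {v} {v′} x∈S 0<f 0<f′ lt lt′ with x ≟ u | other? S u v | other? S u v′
    ... | yes refl | yes oth | yes oth′ = decidable-stable (v ≟ v′) λ v≢v′ →
      ¬br (v , v′ , (0<f , oth) , (0<f′ , oth′) , v≢v′)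
    ... | no x≢u | yes _ | yes _ = uniqueʳ (in- x∈S x≢u) 0<f 0<f′ (s≤s⁻¹ (s≤s⁻¹ lt)) (s≤s⁻¹ (s≤s⁻¹ lt′))

    uniqueˡ′ : ∀ {x x′ v} → x ∈ S → x′ ∈ S → 0 < f x v → 0 < f x′ v → s′ v < r′ x → s′ v < r′ x′ → x ≡ x′
    uniqueˡ′ {x} {x′} {v} x∈S x′∈S 0<f 0<f′ lt lt′ with x ≟ u | x′ ≟ u | other? S u v
    ... | yes refl | yes refl | _ = refl
    ... | no x≢u | _ | no ¬oth = contradiction (x , x∈S , x≢u , 0<f) ¬oth
    ... | _ | no x′≢u | no ¬oth = contradiction (x′ , x′∈S , x′≢u , 0<f′) ¬oth
    ... | yes _ | _ | yes _ = contradiction lt λ { (s≤s ()) }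
    ... | _ | yes _ | yes _ = contradiction lt′ λ { (s≤s ()) }
    ... | no x≢u | no x′≢u | yes _ = uniqueˡ (in- x∈S x≢u) (in- x′∈S x′≢u) 0<f 0<f′
      (s≤s⁻¹ (s≤s⁻¹ lt)) (s≤s⁻¹ (s≤s⁻¹ lt′))

  -- Peel off rows that are not branching, one by one. If rows remain and all of them branch, a walk
  -- among them cannot get stuck and must close a cycle.
  rank : ∀ N S → ∣ S ∣ ≤ N → Ranking f S ⊎ Better f
  rank N S ∣S∣≤N with any? (λ u → (u ∈? S) ×-dec ¬? (branching? S u))
  rank zero S ∣S∣≤N | yes (u , u∈S , _) = contradiction (<-≤-trans (x∈p⇒∣p-x∣<∣p∣ u∈S) ∣S∣≤N) λ ()
  rank (suc N) S ∣S∣≤N | yes (u , u∈S , ¬br)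
    with rank N (S - u) (s≤s⁻¹ (<-≤-trans (x∈p⇒∣p-x∣<∣p∣ u∈S) ∣S∣≤N))
  ... | inj₁ R = inj₁ (prepend u∈S ¬br R)
  ... | inj₂ b = inj₂ b
  rank N S _ | no ¬leaf with nonempty? S
  ... | yes (u , u∈S) = inj₂ (walk-from
    (λ {x} x∈S → decidable-stable (branching? S x) λ ¬br → ¬leaf (x , x∈S , ¬br)) u∈S)
  ... | no empty = inj₁ (record
    { r = λ _ → 0 ; s = λ _ → 0 ; r≢s = λ x∈S → contradiction (_ , x∈S) empty
    ; uniqueʳ = λ x∈S → contradiction (_ , x∈S) empty ; uniqueˡ = λ x∈S → contradiction (_ , x∈S) empty })

-- A matrix maximising Φ among its rearrangements cannot be improved along a cycle.
rearrange : ∀ q (f : Matrix m n) → (∀ v → col f v ≤ q) → ∃[ g ] (Rearranged f g × Ranking g ⊤)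
rearrange {m} {n} q f₀ cap₀ = go _ f₀ cap₀ ≤-refl
  where
  -- Each entry is at most its column sum, hence at most `q`. The gap between `Φ` and this bound
  -- shrinks with every improvement.
  bound : ℕ
  bound = ∑[ u < m ] ∑[ v < n ] (q * q)

  Φ≤bound : ∀ {f : Matrix m n} → (∀ v → col f v ≤ q) → Φ f ≤ bound
  Φ≤bound {f} cap = ∑-mono λ u → ∑-mono λ v → *-mono-≤ (≤q u v) (≤q u v)
    where
    ≤q : ∀ u v → f u v ≤ q
    ≤q u v = ≤-trans (≤∑ (λ x → f x v) u) (cap v)

  go : ∀ N (f : Matrix m n) → (∀ v → col f v ≤ q) → bound ∸ Φ f ≤ N →
       ∃[ g ] (Rearranged f g × Ranking g ⊤)
  go N f cap gap with Rank.rank f _ ⊤ ≤-refl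
  ... | inj₁ R = f , rearranged-refl , R
  ... | inj₂ (g , re , Φ<) = step N gap
    where
    cap′ : ∀ v → col g v ≤ q
    cap′ v = subst (_≤ q) (sym (col≡ re v)) (cap v)

    step : ∀ N → bound ∸ Φ f ≤ N → ∃[ h ] (Rearranged f h × Ranking h ⊤)
    step zero    gap = contradiction (<-≤-trans (∸-monoʳ-< Φ< (Φ≤bound cap′)) gap) λ ()
    step (suc N) gap with go N g cap′ (s≤s⁻¹ (<-≤-trans (∸-monoʳ-< Φ< (Φ≤bound cap′)) gap))
    ... | h , re′ , R = h , rearranged-trans re re′ , R

-- Forests given by a ranking of the vertices

-- A rooted forest with ranks growing towards the roots: the only higher neighbour of a vertex is
-- its parent.
record Ranked (F : BipartiteGraph m n) (ρ : Vertex m n → ℕ) : Set where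
  field
    separated : ∀ {x y} → Adj F x y → ρ x ≢ ρ y
    unique    : ∀ {x y z} → Adj F x y → Adj F x z → ρ x < ρ y → ρ x < ρ z → y ≡ z

Adj-sym : {F : BipartiteGraph m n} → ∀ {x y} → Adj F x y → Adj F y x
Adj-sym (uv v∈) = vu v∈
Adj-sym (vu v∈) = uv v∈

Adj-mono : {F F′ : BipartiteGraph m n} → F′ ⊆ᴱ F → ∀ {x y} → Adj F′ x y → Adj F x y
Adj-mono F′⊆F (uv v∈) = uv (F′⊆F _ v∈)
Adj-mono F′⊆F (vu v∈) = vu (F′⊆F _ v∈)

Ranked-mono : {F F′ : BipartiteGraph m n} {ρ : Vertex m n → ℕ} → F′ ⊆ᴱ F → Ranked F ρ → Ranked F′ ρ
Ranked-mono F′⊆F R = record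
  { separated = separated ∘ Adj-mono F′⊆F
  ; unique    = λ xy xz → unique (Adj-mono F′⊆F xy) (Adj-mono F′⊆F xz)
  }
  where open Ranked R

module _ {F : BipartiteGraph m n} {ρ : Vertex m n → ℕ} (R : Ranked F ρ) where
  open Ranked R

  direction : ∀ {x y} → Adj F x y → ρ x < ρ y ⊎ ρ y < ρ x
  direction {x} {y} xy with <-cmp (ρ x) (ρ y)
  ... | tri< lt _ _ = inj₁ lt
  ... | tri≈ _ eq _ = contradiction eq (separated xy)
  ... | tri> _ _ gt = inj₂ gt

  -- `x` is already the higher neighbour of `y`, so rising from `y` would mean turning back to `x`.
  keeps-falling : ∀ {x y z} → Adj F x y → Adj F y z → x ≢ z → ρ y < ρ x → ρ z < ρ y
  keeps-falling xy yz x≢z y<x with direction yz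
  ... | inj₁ y<z = contradiction (unique (Adj-sym xy) yz y<x y<z) x≢z
  ... | inj₂ z<y = z<y

  EntersFromAbove : Vertex m n → List (Vertex m n) → Set
  EntersFromAbove x ps = Any (λ p → Adj F p x × ρ x < ρ p) ps

  -- After one descent `keeps-falling` applies at every later step, including the last one, into
  -- `x`.
  falling : ∀ {x} a b l → Unique (a ∷ b ∷ l) → All (x ≢_) (a ∷ b ∷ l) → Linked (Adj F) (a ∷ b ∷ l ++ x ∷ []) →
            ρ b < ρ a → ρ x < ρ a × EntersFromAbove x (b ∷ l)
  falling a b [] _ (x≢a ∷ _) (ab ∷ bx ∷ [-]) b<a = <-trans x<b b<a , here (bx , x<b)
    where x<b = keeps-falling ab bx (x≢a ∘ sym) b<a
  falling a b (c ∷ l) ((_ ∷ a≢c ∷ _) ∷ uniq) (_ ∷ x≢) (ab ∷ bc ∷ walk) b<a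
    with falling b c l uniq x≢ (bc ∷ walk) (keeps-falling ab bc a≢c b<a)
  ... | x<b , enters = <-trans x<b b<a , there enters

  -- Either the walk climbs all the way to `x`, or it turns down at some point and then arrives at
  -- `x` from above.
  rising : ∀ {x} a b l → Unique (a ∷ b ∷ l) → All (x ≢_) (a ∷ b ∷ l) → Linked (Adj F) (a ∷ b ∷ l ++ x ∷ []) →
           ρ a < ρ x ⊎ EntersFromAbove x (b ∷ l)
  rising a b l uniq x≢ walk with direction (Linked.head walk)
  rising a b l       uniq x≢ walk             | inj₂ b<a = inj₂ (proj₂ (falling a b l uniq x≢ walk b<a))
  rising a b []      _    _  (_ ∷ bx ∷ [-])   | inj₁ a<b with direction bx
  ... | inj₁ b<x = inj₁ (<-trans a<b b<x)
  ... | inj₂ x<b = inj₂ (here (bx , x<b))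
  rising a b (c ∷ l) (_ ∷ uniq) (_ ∷ x≢) (_ ∷ walk) | inj₁ a<b with rising b c l uniq x≢ walk
  ... | inj₁ b<x    = inj₁ (<-trans a<b b<x)
  ... | inj₂ enters = inj₂ (there enters)

  -- Once a walk without backtracking descends it descends for ever, so a cycle
  -- through x would leave and re-enter x through its only higher neighbour.
  ranked-acyclic : Acyclic F
  ranked-acyclic x (y ∷ [])     (s≤s () , _)
  ranked-acyclic x (y ∷ z ∷ ws) (_ , (x≢@(_ ∷ x≢z ∷ _) ∷ uniq@(y≢ ∷ _)) , (xy ∷ walk)) with direction xy
  ... | inj₂ y<x = <-asym y<x (proj₁ (falling y z ws uniq x≢ walk (keeps-falling xy (Linked.head walk) x≢z y<x)))
  ... | inj₁ x<y with rising y z ws uniq x≢ walk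
  ...   | inj₁ y<x    = <-asym x<y y<x
  ...   | inj₂ enters = All.All¬⇒¬Any (All.map (λ y≢p (px , x<p) →
    y≢p (unique xy (Adj-sym px) x<y x<p)) y≢) enters

  Up : Vertex m n → Vertex m n → Set
  Up x y = Adj F x y × ρ x < ρ y

  up? : ∀ x → Dec (∃[ y ] Up x y)
  up? (inj₁ u) = map′ (λ (v , v∈ , lt) → inj₂ v , uv v∈ , lt) (λ { (_ , uv v∈ , lt) → _ , v∈ , lt })
    (any? λ v → (v ∈? F u) ×-dec (ρ (inj₁ u) <? ρ (inj₂ v)))
  up? (inj₂ v) = map′ (λ (u , v∈ , lt) → inj₁ u , vu v∈ , lt) (λ { (_ , vu v∈ , lt) → _ , v∈ , lt })
    (any? λ u → (v ∈? F u) ×-dec (ρ (inj₂ v) <? ρ (inj₁ u)))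

  -- Passing to the parent raises the rank, which is bounded by `b`; `N` bounds the height left to
  -- climb.
  climb : ∀ {b} → (∀ x → ρ x ≤ b) → ∀ N x → b ∸ ρ x ≤ N → ∃[ z ] (Star Up x z × ¬ (∃[ y ] Up z y))
  climb ρ≤b N x gap with up? x
  ... | no ¬up = x , ε , ¬up
  climb {b} ρ≤b N x gap | yes (y , x→y@(_ , x<y)) = step N gap
    where
    step : ∀ N → b ∸ ρ x ≤ N → ∃[ z ] (Star Up x z × ¬ (∃[ y ] Up z y))
    step zero    gap = contradiction (<-≤-trans (∸-monoʳ-< x<y (ρ≤b y)) gap) λ ()
    step (suc N) gap with climb ρ≤b N y (s≤s⁻¹ (<-≤-trans (∸-monoʳ-< x<y (ρ≤b y)) gap))
    ... | z , up , root = z , x→y ◅ up , root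

  -- A step to a child lengthens the climb to `z` by one edge; a step to a parent removes its first
  -- edge, since parents are unique.
  same-root : ∀ {x y z} → ¬ (∃[ w ] Up z w) → Star Up x z → Reachable F x y → Star Up y z
  same-root root up ε = up
  same-root root up (xw ◅ path) with direction xw
  ... | inj₂ w<x = same-root root ((Adj-sym xw , w<x) ◅ up) path
  same-root root ε                    (xw ◅ path) | inj₁ x<w = contradiction (_ , xw , x<w) root
  same-root root ((xw′ , x<w′) ◅ up) (xw ◅ path) | inj₁ x<w with unique xw xw′ x<w x<w′
  ... | refl = same-root root up path

  -- All vertices of the component climb to the same `z`, and a climb from any other vertex starts
  -- with a step to its parent.
  root-of-component : ∀ {b} → (∀ x → ρ x ≤ b) → ∀ x →
                      ∃[ z ] (∀ {y} → Reachable F x y → y ≢ z → ∃[ w ] Up y w)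
  root-of-component ρ≤b x with climb ρ≤b _ x ≤-refl
  ... | z , x↑z , root = z , λ path y≢z → first (same-root root x↑z path) y≢z
    where
    first : ∀ {y z} → Star Up y z → y ≢ z → ∃[ w ] Up y w
    first ε        y≢y = contradiction refl y≢y
    first (up ◅ _) _   = _ , up

-- Induced subgraphs and components

∈-induced⁺ : (F : BipartiteGraph m n) {A : Subset m} {B : Subset n} → ∀ {u v} →
             u ∈ A → v ∈ B → v ∈ F u → v ∈ (F [ A , B ]) u
∈-induced⁺ F {A} {B} {u} u∈A v∈B v∈F rewrite dec-true (u ∈? A) u∈A = x∈p∩q⁺ (v∈F , v∈B)

induced-⊆ᴱ : (F : BipartiteGraph m n) (C : VertexSet m n) → (F [ C ]) ⊆ᴱ F
induced-⊆ᴱ F (A , B) u v∈ with u ∈? A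
... | yes _ = p∩q⊆p (F u) B v∈
... | no _  = contradiction v∈ ∉⊥

sum-tabulate : (f : Fin n → ℕ) → Vec.sum (tabulate f) ≡ sum f
sum-tabulate {zero}  f = refl
sum-tabulate {suc n} f = cong (f zero +_) (sum-tabulate (f ∘ suc))

size-induced-≤ : (F : BipartiteGraph m n) {h : ℕ} → (∀ u → deg F u ≡ h) → ∀ A B → size (F [ A , B ]) ≤ h * ∣ A ∣
size-induced-≤ {m} {n} F {h} deg≡h A B = begin
  size (F [ A , B ])               ≡⟨ sum-tabulate (λ u → ∣ (F [ A , B ]) u ∣) ⟩
  ∑[ u < m ] ∣ (F [ A , B ]) u ∣   ≤⟨ ∑-mono bound ⟩
  ∑[ u < m ] (𝟙 (u ∈? A) * h)      ≡⟨ ∑𝟙∈* A h ⟩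
  h * ∣ A ∣                        ∎
  where
  open ≤-Reasoning
  bound : ∀ u → ∣ (F [ A , B ]) u ∣ ≤ 𝟙 (u ∈? A) * h
  bound u with u ∈? A
  ... | yes _ = ≤-trans (∣p∩q∣≤∣p∣ (F u) B) (≤-reflexive (trans (deg≡h u) (sym (*-identityˡ h))))
  ... | no _  = ≤-reflexive (∣⊥∣≡0 n)

module _ {F : BipartiteGraph m n} {C : VertexSet m n} (comp : IsComponent F C) where

  private
    x₀  = proj₁ comp
    C⇔ = proj₂ comp

  component-reach : ∀ {y} → y ∈ⱽ C → Reachable F x₀ y
  component-reach {y} = Equivalence.to (C⇔ y)

  component-closed : ∀ {x y} → x ∈ⱽ C → Adj F x y → y ∈ⱽ C
  component-closed {x} {y} x∈C xy = Equivalence.from (C⇔ y) (component-reach x∈C ◅◅ xy ◅ ε)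

  component-Adj : ∀ {x y} → x ∈ⱽ C → Adj F x y → Adj (F [ C ]) x y
  component-Adj x∈C (uv v∈F) = uv (∈-induced⁺ F x∈C (component-closed x∈C (uv v∈F)) v∈F)
  component-Adj x∈C (vu v∈F) = vu (∈-induced⁺ F (component-closed x∈C (vu v∈F)) x∈C v∈F)

  -- Join the two vertices through the base point `x₀`; a path that starts in a component never
  -- leaves it.
  component-connected : ∀ {x y} → x ∈ⱽ C → y ∈ⱽ C → Reachable (F [ C ]) x y
  component-connected x∈C y∈C = inside-C x∈C (reverse Adj-sym (component-reach x∈C) ◅◅ component-reach y∈C)
    where
    inside-C : ∀ {x y} → x ∈ⱽ C → Reachable F x y → Reachable (F [ C ]) x y
    inside-C x∈C ε           = ε
    inside-C x∈C (xy ◅ path) = component-Adj x∈C xy ◅ inside-C (component-closed x∈C xy) path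

  ranked-component-tree : {ρ : Vertex m n → ℕ} → Ranked F ρ → IsTreeOn F C
  ranked-component-tree R = record
    { nonempty  = x₀ , Equivalence.from (C⇔ x₀) ε
    ; connected = component-connected
    ; acyclic   = ranked-acyclic (Ranked-mono (induced-⊆ᴱ F C) R)
    }

-- Counting in subsets and among the vertices

subset-of-size : (p : Subset n) → ∀ k → k ≤ ∣ p ∣ → ∃[ p′ ] (p′ ⊆ p × ∣ p′ ∣ ≡ k)
subset-of-size {n} p zero k≤ = ⊥ , (λ x∈⊥ → contradiction x∈⊥ ∉⊥) , ∣⊥∣≡0 n
subset-of-size (outside ∷ p) (suc k) k≤ with subset-of-size p (suc k) k≤
... | p′ , p′⊆p , ∣p′∣≡k = outside ∷ p′ , s⊆s p′⊆p , ∣p′∣≡k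
subset-of-size (inside ∷ p) (suc k) k≤ with subset-of-size p k (s≤s⁻¹ k≤)
... | p′ , p′⊆p , ∣p′∣≡k = inside ∷ p′ , s⊆s p′⊆p , cong suc ∣p′∣≡k

-- For the neighbours `p` and the children `p′` of a left vertex, whose parent is the one element
-- that may be missing.
∣p∣≤1+∣p′∣ : (p p′ : Subset n) → (∀ {x y} → x ∈ p → x ∉ p′ → y ∈ p → y ∉ p′ → x ≡ y) → ∣ p ∣ ≤ suc ∣ p′ ∣
∣p∣≤1+∣p′∣ {n} p p′ unique with any? (λ x → (x ∈? p) ×-dec ¬? (x ∈? p′))
... | no ¬x = m≤n⇒m≤1+n (p⊆q⇒∣p∣≤∣q∣ λ {x} x∈p → decidable-stable (x ∈? p′) λ x∉p′ → ¬x (x , x∈p , x∉p′))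
... | yes (x , x∈p , x∉p′) = begin
  ∣ p ∣                                              ≡⟨ ∣p∣≡∑ p ⟩
  ∑[ y < n ] 𝟙 (y ∈? p)                              ≤⟨ ∑-mono cover ⟩
  ∑[ y < n ] (𝟙 (y ≟ x) + 𝟙 (y ∈? p′))               ≡⟨ ∑-distrib-+ (λ (y : Fin n) → 𝟙 (y ≟ x))
                                                          (λ y → 𝟙 (y ∈? p′)) ⟩
  ∑[ y < n ] 𝟙 (y ≟ x) + ∑[ y < n ] 𝟙 (y ∈? p′)      ≡⟨ cong₂ _+_ (∑𝟙≟ x) (sym (∣p∣≡∑ p′)) ⟩
  suc ∣ p′ ∣                                         ∎
  where
  open ≤-Reasoning
  cover : ∀ y → 𝟙 (y ∈? p) ≤ 𝟙 (y ≟ x) + 𝟙 (y ∈? p′)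
  cover y with y ∈? p | y ∈? p′ | y ≟ x
  ... | no _    | _        | _      = z≤n
  ... | yes _   | yes _    | _      = m≤n+m 1 _
  ... | yes _   | no _     | yes _  = ≤-refl
  ... | yes y∈p | no y∉p′  | no y≢x = contradiction (unique y∈p y∉p′ x∈p x∉p′) y≢x

_≟ⱽ_ : DecidableEquality (Vertex m n)
_≟ⱽ_ = ≡-dec _≟_ _≟_

∑𝟙≟ⱽ : (z : Vertex m n) → ∑[ u < m ] 𝟙 (inj₁ u ≟ⱽ z) + ∑[ v < n ] 𝟙 (inj₂ v ≟ⱽ z) ≡ 1
∑𝟙≟ⱽ {m} {n} (inj₁ u) = cong₂ _+_ (∑𝟙≟ u) (∑0 n)
∑𝟙≟ⱽ {m} {n} (inj₂ v) = cong₂ _+_ (∑0 m) (∑𝟙≟ v)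

-- Selecting `h` edges at every left vertex of the forest

module Selection {m n : ℕ} (f : Matrix m n) (q′ h′ : ℕ)
  (row≡ : ∀ u → row f u ≡ suc q′ * h′ + 1) (col≤ : ∀ v → col f v ≤ suc q′)
  (R : Ranking f ⊤) where

  open Ranking R

  private
    q h : ℕ
    q = suc q′
    h = suc h′

  -- In the rooted forest, the neighbours of `u` and its children.
  Support Low : Fin m → Subset n
  Support u = ⟪ (λ v → 0 <? f u v) ⟫
  Low u = ⟪ (λ v → (0 <? f u v) ×-dec (s v <? r u)) ⟫

  ∈Support⁻ : ∀ {u v} → v ∈ Support u → 0 < f u v
  ∈Support⁻ {u} = ∈⟪⟫⁻ λ v → 0 <? f u v

  ∈Low⁻ : ∀ {u v} → v ∈ Low u → 0 < f u v × s v < r u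
  ∈Low⁻ {u} = ∈⟪⟫⁻ λ v → (0 <? f u v) ×-dec (s v <? r u)

  -- Entries are at most `q`, so `h′` of them carry at most `q * h′`, one unit short of the row sum.
  h≤∣Support∣ : ∀ u → h ≤ ∣ Support u ∣
  h≤∣Support∣ u = *-cancelˡ-< q h′ ∣ Support u ∣ (begin
    suc (q * h′)                           ≡⟨ +-comm 1 (q * h′) ⟩
    q * h′ + 1                             ≡⟨ row≡ u ⟨
    row f u                                ≤⟨ ∑-mono bound ⟩
    ∑[ v < n ] (𝟙 (v ∈? Support u) * q)    ≡⟨ ∑𝟙∈* (Support u) q ⟩
    q * ∣ Support u ∣                      ∎)
    where
    open ≤-Reasoning
    bound : ∀ v → f u v ≤ 𝟙 (v ∈? Support u) * q
    bound v with v ∈? Support u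
    ... | yes _ = ≤-trans (≤-trans (≤∑ (λ x → f x v) u) (col≤ v)) (≤-reflexive (sym (*-identityˡ q)))
    ... | no v∉ = ≮⇒≥ λ 0<f → v∉ (∈⟪⟫⁺ (λ v → 0 <? f u v) 0<f)

  upper : ∀ {u v} → v ∈ Support u → v ∉ Low u → r u < s v
  upper {u} {v} v∈ v∉ = ≤∧≢⇒< (≮⇒≥ λ s<r → v∉ (∈⟪⟫⁺ (λ v → (0 <? f u v) ×-dec (s v <? r u)) (∈Support⁻ v∈ , s<r)))
    (r≢s ∈⊤ (∈Support⁻ v∈))

  -- With fewer than `h` children and one possible parent, `u` has exactly `h` neighbours and keeps
  -- them all. The final alternative records that a vertex which keeps its parent loses no edge.
  select : ∀ u → ∃[ p ] (p ⊆ Support u × ∣ p ∣ ≡ h × (p ⊆ Low u ⊎ Support u ⊆ p))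
  select u with h ≤? ∣ Low u ∣
  ... | yes h≤ with subset-of-size (Low u) h h≤
  ...   | p , p⊆Low , ∣p∣≡h = p , ∈⟪⟫⁺ (λ v → 0 <? f u v) ∘ proj₁ ∘ ∈Low⁻ ∘ p⊆Low , ∣p∣≡h , inj₁ p⊆Low
  select u | no h≰ = Support u , (λ v∈ → v∈) , ≤-antisym
    (≤-trans (∣p∣≤1+∣p′∣ (Support u) (Low u) λ x∈ x∉ y∈ y∉ →
      uniqueʳ ∈⊤ (∈Support⁻ x∈) (∈Support⁻ y∈) (upper x∈ x∉) (upper y∈ y∉)) (≰⇒> h≰))
    (h≤∣Support∣ u) , inj₂ (λ v∈ → v∈)

  F : BipartiteGraph m n
  F = proj₁ ∘ select

  F⊆Support : ∀ {u v} → v ∈ F u → 0 < f u v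
  F⊆Support {u} v∈ = ∈Support⁻ (proj₁ (proj₂ (select u)) v∈)

  deg≡h : ∀ u → deg F u ≡ h
  deg≡h u = proj₁ (proj₂ (proj₂ (select u)))

  ρ : Vertex m n → ℕ
  ρ (inj₁ u) = r u
  ρ (inj₂ v) = s v

  ranked : Ranked F ρ
  ranked = record { separated = separated ; unique = unique }
    where
    separated : ∀ {x y} → Adj F x y → ρ x ≢ ρ y
    separated (uv v∈) = r≢s ∈⊤ (F⊆Support v∈)
    separated (vu v∈) = r≢s ∈⊤ (F⊆Support v∈) ∘ sym

    unique : ∀ {x y z} → Adj F x y → Adj F x z → ρ x < ρ y → ρ x < ρ z → y ≡ z
    unique (uv v∈) (uv v∈′) lt lt′ = cong inj₂ (uniqueʳ ∈⊤ (F⊆Support v∈) (F⊆Support v∈′) lt lt′)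
    unique (vu v∈) (vu v∈′) lt lt′ = cong inj₁ (uniqueˡ ∈⊤ ∈⊤ (F⊆Support v∈) (F⊆Support v∈′) lt lt′)

  ρ≤ : ∀ x → ρ x ≤ sum r + sum s
  ρ≤ (inj₁ u) = ≤-trans (≤∑ r u) (m≤m+n _ _)
  ρ≤ (inj₂ v) = ≤-trans (≤∑ s v) (m≤n+m _ _)

  module _ {A : Subset m} {B : Subset n} (comp : IsComponent F (A , B)) where

    private
      root : Vertex m n
      root = proj₁ (root-of-component ranked ρ≤ (proj₁ comp))

      parent : ∀ {y} → y ∈ⱽ (A , B) → y ≢ root → ∃[ w ] Up ranked y w
      parent y∈C = proj₂ (root-of-component ranked ρ≤ (proj₁ comp)) (component-reach comp y∈C)

      down? : ∀ u v → Dec (v ∈ F u × s v < r u)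
      down? u v = (v ∈? F u) ×-dec (s v <? r u)

      rootˡ rootʳ : ℕ
      rootˡ = ∑[ u < m ] 𝟙 (inj₁ u ≟ⱽ root)
      rootʳ = ∑[ v < n ] 𝟙 (inj₂ v ≟ⱽ root)

    -- Every vertex of B but the root has a parent in A, and every vertex of A
    -- but the root has at most h′ children.
    ∣B∣≤ : ∣ B ∣ ≤ h′ * ∣ A ∣ + 1
    ∣B∣≤ = begin
      ∣ B ∣
        ≡⟨ ∣p∣≡∑ B ⟩
      ∑[ v < n ] 𝟙 (v ∈? B)
        ≤⟨ ∑-mono hasParent ⟩
      ∑[ v < n ] (∑[ u < m ] (𝟙 (u ∈? A) * 𝟙 (down? u v)) + 𝟙 (inj₂ v ≟ⱽ root))
        ≡⟨ ∑-distrib-+ (λ v → ∑[ u < m ] (𝟙 (u ∈? A) * 𝟙 (down? u v))) (λ v → 𝟙 (inj₂ v ≟ⱽ root)) ⟩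
      ∑[ v < n ] ∑[ u < m ] (𝟙 (u ∈? A) * 𝟙 (down? u v)) + rootʳ
        ≡⟨ cong (_+ rootʳ) (∑-comm (λ v u → 𝟙 (u ∈? A) * 𝟙 (down? u v))) ⟩
      ∑[ u < m ] ∑[ v < n ] (𝟙 (u ∈? A) * 𝟙 (down? u v)) + rootʳ
        ≡⟨ cong (_+ rootʳ) (sum-cong-≗ λ u → *-distribˡ-sum (𝟙 (u ∈? A)) (λ (v : Fin n) → 𝟙 (down? u v))) ⟨
      ∑[ u < m ] (𝟙 (u ∈? A) * ∑[ v < n ] 𝟙 (down? u v)) + rootʳ
        ≤⟨ +-monoˡ-≤ rootʳ (∑-mono fewChildren) ⟩
      ∑[ u < m ] (𝟙 (u ∈? A) * h′ + 𝟙 (inj₁ u ≟ⱽ root)) + rootʳ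
        ≡⟨ cong (_+ rootʳ) (∑-distrib-+ (λ u → 𝟙 (u ∈? A) * h′) (λ u → 𝟙 (inj₁ u ≟ⱽ root))) ⟩
      ∑[ u < m ] (𝟙 (u ∈? A) * h′) + rootˡ + rootʳ
        ≡⟨ +-assoc (∑[ u < m ] (𝟙 (u ∈? A) * h′)) rootˡ rootʳ ⟩
      ∑[ u < m ] (𝟙 (u ∈? A) * h′) + (rootˡ + rootʳ)
        -- The root is a single vertex on one of the two sides, so both exceptions together cost 1.
        ≡⟨ cong₂ _+_ (∑𝟙∈* A h′) (∑𝟙≟ⱽ root) ⟩
      h′ * ∣ A ∣ + 1
        ∎
      where
      open ≤-Reasoning
      hasParent : ∀ v → 𝟙 (v ∈? B) ≤ ∑[ u < m ] (𝟙 (u ∈? A) * 𝟙 (down? u v)) + 𝟙 (inj₂ v ≟ⱽ root)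
      hasParent v with v ∈? B
      ... | no _ = z≤n
      ... | yes v∈B with inj₂ v ≟ⱽ root
      ...   | yes _ = m≤n+m 1 _
      ...   | no v≢root with parent v∈B v≢root
      ...     | _ , e@(vu {u} v∈Fu) , s<r = ≤-trans (≤-reflexive (sym (cong₂ _*_
        (𝟙-yes (u ∈? A) (component-closed comp v∈B e)) (𝟙-yes (down? u v) (v∈Fu , s<r)))))
        (≤-trans (≤∑ (λ u → 𝟙 (u ∈? A) * 𝟙 (down? u v)) u) (m≤m+n _ _))

      children≤ : ∀ u v → 𝟙 (down? u v) ≤ 𝟙 (v ∈? F u)
      children≤ u v = 𝟙-mono (down? u v) (v ∈? F u) proj₁

      ∑F : ∀ u → ∑[ v < n ] 𝟙 (v ∈? F u) ≡ h
      ∑F u = trans (sym (∣p∣≡∑ (F u))) (deg≡h u)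

      -- At the root all `h = h′ + 1` neighbours may be children, and its indicator pays for the
      -- extra one. Elsewhere the parent is among the `h` neighbours, which leaves at most `h′`
      -- children.
      fewChildren : ∀ u → 𝟙 (u ∈? A) * ∑[ v < n ] 𝟙 (down? u v) ≤ 𝟙 (u ∈? A) * h′ + 𝟙 (inj₁ u ≟ⱽ root)
      fewChildren u with u ∈? A
      ... | no _ = z≤n
      ... | yes u∈A rewrite *-identityˡ (∑[ v < n ] 𝟙 (down? u v)) | *-identityˡ h′ with inj₁ u ≟ⱽ root
      ...   | yes _ = ≤-trans (∑-mono (children≤ u)) (≤-reflexive (trans (∑F u) (+-comm 1 h′)))
      ...   | no u≢root with parent u∈A u≢root
      ...     | _ , uv {v = v} v∈Fu , r<s = ≤-trans (s≤s⁻¹ (<-≤-trans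
        (∑-mono-< (children≤ u) v (subst₂ _<_ (sym (𝟙-no (down? u v) λ (_ , s<r) → <-asym r<s s<r))
          (sym (𝟙-yes (v ∈? F u) v∈Fu)) (s≤s z≤n)))
        (≤-reflexive (∑F u)))) (≤-reflexive (sym (+-identityʳ h′)))

    -- All the flow of A ends in B, except that the root may have lost all but
    -- the h ≥ 1 units guaranteed by its selected edges.
    d∣A∣≤ : (q * h′ + 1) * ∣ A ∣ ≤ q * ∣ B ∣ + q′ * h′
    d∣A∣≤ = begin
      d * ∣ A ∣
        ≡⟨ ∑𝟙∈* A d ⟨
      ∑[ u < m ] (𝟙 (u ∈? A) * d)
        ≤⟨ ∑-mono (λ u → 𝟙*-≤ (u ∈? A) (retained u)) ⟩
      ∑[ u < m ] (∑[ v < n ] (𝟙 (v ∈? B) * f u v) + 𝟙 (inj₁ u ≟ⱽ root) * (q′ * h′))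
        ≡⟨ ∑-distrib-+ (λ u → ∑[ v < n ] (𝟙 (v ∈? B) * f u v)) (λ u → 𝟙 (inj₁ u ≟ⱽ root) * (q′ * h′)) ⟩
      ∑[ u < m ] ∑[ v < n ] (𝟙 (v ∈? B) * f u v) + ∑[ u < m ] (𝟙 (inj₁ u ≟ⱽ root) * (q′ * h′))
        ≡⟨ cong₂ _+_ (∑-comm (λ u v → 𝟙 (v ∈? B) * f u v))
             (sym (*-distribʳ-sum (q′ * h′) (λ (u : Fin m) → 𝟙 (inj₁ u ≟ⱽ root)))) ⟩
      ∑[ v < n ] ∑[ u < m ] (𝟙 (v ∈? B) * f u v) + rootˡ * (q′ * h′)
        ≡⟨ cong (_+ rootˡ * (q′ * h′)) (sum-cong-≗ λ v → *-distribˡ-sum (𝟙 (v ∈? B)) (λ (u : Fin m) → f u v)) ⟨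
      ∑[ v < n ] (𝟙 (v ∈? B) * col f v) + rootˡ * (q′ * h′)
        ≤⟨ +-mono-≤ (∑-mono λ v → *-monoʳ-≤ (𝟙 (v ∈? B)) (col≤ v)) (*-monoˡ-≤ (q′ * h′) rootˡ≤1) ⟩
      ∑[ v < n ] (𝟙 (v ∈? B) * q) + 1 * (q′ * h′)
        ≡⟨ cong₂ _+_ (∑𝟙∈* B q) (*-identityˡ (q′ * h′)) ⟩
      q * ∣ B ∣ + q′ * h′
        ∎
      where
      open ≤-Reasoning
      d = q * h′ + 1

      rootˡ≤1 : rootˡ ≤ 1
      rootˡ≤1 = ≤-trans (m≤m+n rootˡ rootʳ) (≤-reflexive (∑𝟙≟ⱽ root))

      F⊆B : ∀ {u v} → u ∈ A → v ∈ F u → v ∈ B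
      F⊆B u∈A v∈Fu = component-closed comp u∈A (uv v∈Fu)

      retained : ∀ u → u ∈ A → d ≤ ∑[ v < n ] (𝟙 (v ∈? B) * f u v) + 𝟙 (inj₁ u ≟ⱽ root) * (q′ * h′)
      retained u u∈A with inj₁ u ≟ⱽ root
      -- Each of the `h` selected edges carries at least one unit, and `d` exceeds `h` by `q′ * h′`.
      ... | yes _ = begin
        q * h′ + 1                                       ≡⟨ split h′ q′ ⟩
        h + 1 * (q′ * h′)                                ≡⟨ cong (_+ 1 * (q′ * h′))
                                                              (trans (sym (deg≡h u)) (∣p∣≡∑ (F u))) ⟩
        ∑[ v < n ] 𝟙 (v ∈? F u) + 1 * (q′ * h′)          ≤⟨ +-monoˡ-≤ (1 * (q′ * h′)) (∑-mono bound) ⟩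
        ∑[ v < n ] (𝟙 (v ∈? B) * f u v) + 1 * (q′ * h′)  ∎
        where
        split : ∀ h′ q′ → suc q′ * h′ + 1 ≡ suc h′ + 1 * (q′ * h′)
        split = solve-∀
        bound : ∀ v → 𝟙 (v ∈? F u) ≤ 𝟙 (v ∈? B) * f u v
        bound v with v ∈? F u
        ... | no _ = z≤n
        ... | yes v∈Fu rewrite 𝟙-yes (v ∈? B) (F⊆B u∈A v∈Fu) | *-identityˡ (f u v) = F⊆Support v∈Fu
      ... | no u≢root = begin
        q * h′ + 1                           ≡⟨ row≡ u ⟨
        row f u                              ≤⟨ ∑-mono bound ⟩
        ∑[ v < n ] (𝟙 (v ∈? B) * f u v)      ≡⟨ +-identityʳ _ ⟨
        ∑[ v < n ] (𝟙 (v ∈? B) * f u v) + 0  ∎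
        where
        -- The selected edge to the parent excludes the case in which only children were selected.
        Support⊆F : Support u ⊆ F u
        Support⊆F with proj₂ (proj₂ (proj₂ (select u))) | parent u∈A u≢root
        ... | inj₂ Support⊆F | _ = Support⊆F
        ... | inj₁ F⊆Low | _ , uv v∈Fu , r<s = contradiction (proj₂ (∈Low⁻ (F⊆Low v∈Fu))) (<-asym r<s)

        bound : ∀ v → f u v ≤ 𝟙 (v ∈? B) * f u v
        bound v with v ∈? B
        ... | yes _ = ≤-reflexive (sym (*-identityˡ (f u v)))
        ... | no v∉B = ≮⇒≥ λ 0<f → v∉B (F⊆B u∈A (Support⊆F (∈⟪⟫⁺ (λ v → 0 <? f u v) 0<f)))

    -- Inserting the bound on `∣ B ∣` into that on the flow cancels `q * h′ * ∣ A ∣`; the rest is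
    -- `q + q′ * h′ = q′ * h + 1`.
    ∣A∣≤ : ∣ A ∣ ≤ q′ * h + 1
    ∣A∣≤ = +-cancelˡ-≤ (q * (h′ * ∣ A ∣)) _ _ (begin
      q * (h′ * ∣ A ∣) + ∣ A ∣                ≡⟨ expandˡ q h′ ∣ A ∣ ⟨
      (q * h′ + 1) * ∣ A ∣                    ≤⟨ d∣A∣≤ ⟩
      q * ∣ B ∣ + q′ * h′                     ≤⟨ +-monoˡ-≤ (q′ * h′) (*-monoʳ-≤ q ∣B∣≤) ⟩
      q * (h′ * ∣ A ∣ + 1) + q′ * h′          ≡⟨ expandʳ q′ h′ (h′ * ∣ A ∣) ⟩
      q * (h′ * ∣ A ∣) + (q′ * h + 1)         ∎)
      where
      open ≤-Reasoning
      expandˡ : ∀ q h a → (q * h + 1) * a ≡ q * (h * a) + a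
      expandˡ = solve-∀
      expandʳ : ∀ q h c → suc q * (c + 1) + q * h ≡ suc q * c + (q * suc h + 1)
      expandʳ = solve-∀

  isMatching : {E : BipartiteGraph m n} → (∀ {u v} → 0 < f u v → v ∈ E u) →
               ∀ {k} → q′ * h + 1 ≤ k → IsMatching h (h * k) E F
  isMatching supp {k} bound = record
    { subgraph       = λ u v∈Fu → supp (F⊆Support v∈Fu)
    ; component-tree = λ C comp → ranked-component-tree comp ranked
    ; component-size = λ (A , B) comp →
        ≤-trans (size-induced-≤ F deg≡h A B) (*-monoʳ-≤ h (≤-trans (∣A∣≤ comp) bound))
    ; degree         = deg≡h
    }

-- The theorem with an integral expansion hypothesis

matching : ∀ q′ h′ k → suc q′ * suc h′ ≤ k + h′ → (G : BipartiteGraph m n) →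
           (∀ S → (suc q′ * h′ + 1) * ∣ S ∣ ≤ suc q′ * ∣ Γ G S ∣) →
           ∃[ F ] IsMatching (suc h′) (suc h′ * k) G F
matching q′ h′ k qh≤ G expand with Hall.saturating G (suc q′) (suc q′ * h′ + 1) expand
... | f , flow , row≡d with rearrange (suc q′) f (Hall.Flow.cap flow)
...   | g , re , R = Selection.F g q′ h′ row≡′ col≤′ R ,
  Selection.isMatching g q′ h′ row≡′ col≤′ R (Hall.Flow.supp flow ∘ Rearranged.supp⊆ re) bound
  where
  row≡′ : ∀ u → row g u ≡ suc q′ * h′ + 1
  row≡′ u = trans (Rearranged.row≡ re u) (row≡d u)

  col≤′ : ∀ v → col g v ≤ suc q′
  col≤′ v = subst (_≤ suc q′) (sym (Rearranged.col≡ re v)) (Hall.Flow.cap flow v)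

  -- Expand `suc q′ * suc h′` as `q′ * suc h′ + 1 + h′` and cancel `h′`.
  bound : q′ * suc h′ + 1 ≤ k
  bound = +-cancelʳ-≤ h′ _ _ (≤-trans (≤-reflexive (rotate h′ (q′ * suc h′))) qh≤)
    where
    rotate : ∀ a b → b + 1 + a ≡ suc a + b
    rotate = solve-∀

-- Clearing denominators in the expansion hypothesis

open import Data.Integer.Base using (+_)

fromℕ-≃ : ∀ a → toℚᵘ (fromℕ a) ≃ mkℚᵘ (+ a) 0
fromℕ-≃ a = ℚ.toℚᵘ-fromℚᵘ (mkℚᵘ (+ a) 0)

-- On unnormalised rationals numerator and denominator are explicit polynomials, with no reduction
-- to lowest terms.
expansion-≃ : ∀ h q a → toℚᵘ ((fromℕ h ℚ.- 1ℚ ℚ.+ (+ 1 ℚ./ suc q)) ℚ.* fromℕ a) ≃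
              (mkℚᵘ (+ h) 0 ℚᵘ.- ℚᵘ.1ℚᵘ ℚᵘ.+ mkℚᵘ (+ 1) q) ℚᵘ.* mkℚᵘ (+ a) 0
expansion-≃ h q a =
  ℚᵘ.≃-trans (ℚ.toℚᵘ-homo-* (fromℕ h ℚ.- 1ℚ ℚ.+ (+ 1 ℚ./ suc q)) (fromℕ a)) (ℚᵘ.*-cong
    (ℚᵘ.≃-trans (ℚ.toℚᵘ-homo-+ (fromℕ h ℚ.- 1ℚ) (+ 1 ℚ./ suc q)) (ℚᵘ.+-cong
      (ℚᵘ.≃-trans (ℚ.toℚᵘ-homo-+ (fromℕ h) (ℚ.- 1ℚ)) (ℚᵘ.+-congˡ (toℚᵘ (ℚ.- 1ℚ)) (fromℕ-≃ h)))
      (ℚ.toℚᵘ-fromℚᵘ (mkℚᵘ (+ 1) q))))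
    (fromℕ-≃ a))

-- Here `h` is one less than in the theorem. The order on unnormalised rationals is cross
-- multiplication, and both products simplify in the integers.
clear-denominators : ∀ h q a b → (fromℕ (suc h) ℚ.- 1ℚ ℚ.+ (+ 1 ℚ./ suc q)) ℚ.* fromℕ a ℚ.≤ fromℕ b →
                     (suc q * h + 1) * a ≤ suc q * b
clear-denominators h q a b le
  with ℚᵘ.≤-respˡ-≃ (expansion-≃ (suc h) q a) (ℚᵘ.≤-respʳ-≃ (fromℕ-≃ b) (ℚ.toℚᵘ-mono-≤ le))
... | *≤* le′ = ℤ.drop‿+≤+ (subst₂ ℤ._≤_ numerator denominator le′)
  where
  open ≡-Reasoning

  simplify : ∀ H Q A → ((((+ 1 ℤ.+ H) ℤ.* + 1 ℤ.+ ℤ.- (+ 1) ℤ.* + 1) ℤ.* Q ℤ.+ + 1 ℤ.* + 1) ℤ.* A) ℤ.* + 1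
             ≡ (Q ℤ.* H ℤ.+ + 1) ℤ.* A
  simplify = ℤ.solve-∀

  numerator : ((((+ suc h) ℤ.* + 1 ℤ.+ ℤ.- (+ 1) ℤ.* + 1) ℤ.* + suc q ℤ.+ + 1 ℤ.* + 1) ℤ.* + a) ℤ.* + 1
              ≡ + ((suc q * h + 1) * a)
  numerator = begin
    _                                       ≡⟨ simplify (+ h) (+ suc q) (+ a) ⟩
    (+ suc q ℤ.* + h ℤ.+ + 1) ℤ.* + a       ≡⟨ cong (λ x → (x ℤ.+ + 1) ℤ.* + a) (ℤ.pos-* (suc q) h) ⟨
    + (suc q * h + 1) ℤ.* + a               ≡⟨ ℤ.pos-* (suc q * h + 1) a ⟨
    + ((suc q * h + 1) * a)                 ∎

  denominator : + b ℤ.* + (1 * 1 * suc q * 1) ≡ + (suc q * b)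
  denominator = begin
    + b ℤ.* + (1 * 1 * suc q * 1)  ≡⟨ ℤ.pos-* b (1 * 1 * suc q * 1) ⟨
    + (b * (1 * 1 * suc q * 1))    ≡⟨ cong +_ (rearranged b (suc q)) ⟩
    + (suc q * b)                  ∎
    where
    rearranged : ∀ b q → b * (1 * 1 * q * 1) ≡ q * b
    rearranged = solve-∀

-- `q` replaces `⌈ k / h ⌉` by a variable, so that it can be matched with a successor.
matching-ℚ : ∀ q h .{{_ : NonZero q}} .{{_ : NonZero h}} k → q * h ≤ k + pred h → (G : BipartiteGraph m n) →
             (∀ S → fromℕ ∣ Γ G S ∣ ℚ.≥ (fromℕ h ℚ.- 1ℚ ℚ.+ (+ 1 ℚ./ q)) ℚ.* fromℕ ∣ S ∣) →
             ∃[ F ] IsMatching h (h * k) G F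
matching-ℚ (suc q) (suc h) k qh≤ G expand =
  matching q h k qh≤ G λ S → clear-denominators h q ∣ S ∣ ∣ Γ G S ∣ (expand S)

theorem1p3 : ∀ (k h : ℕ) .{{_ : NonZero k}} .{{_ : NonTrivial h}} {m n : ℕ} (G : BipartiteGraph m n) →
    (∀ (S : Subset m) → fromℕ ∣ Γ G S ∣ ℚ.≥ expansion k h ℚ.* fromℕ ∣ S ∣) →
    ∃[ F ] IsMatching h (h * k) G F
theorem1p3 k h = matching-ℚ ⌈ k / h ⌉ h k (m/n*n≤m (k + pred h) h)
  where instance
    h≢0 : NonZero h
    h≢0 = nonTrivial⇒nonZero h
    ⌈k/h⌉≢0 : NonZero ⌈ k / h ⌉
    ⌈k/h⌉≢0 = ⌈/⌉-nonZero k h
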